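{- Let $n \ge 3$ and $m \ge 2$ be integers, and let $t$ be the minimum natural number such that $m \le 1 + nt + \frac{t(t-1)}{2}$. The lollipop graph $L_{n,m}$ has harmonious chromatic number $h(L_{n,m}) = n+t$ in the following cases: \begin{itemize} \item $t$ is even and $n$ is odd; \item $t$ and $n$ are even and $m \le 1 + nt + \frac{t(t-1)}{2} - \frac{t}{2}$; \item $t$ is odd, $n$ is even and $m \le 1 + nt + \frac{t(t-1)}{2} - (n-2)$; \item $t$ and $n$ are odd and $m \le 1 + nt + \frac{t(t-1)}{2} - \left(n-2+\max\left(\frac{t-(n-2)}{2},0\right)\right)$. \end{itemize} Otherwise, $h(L_{n,m}) = n+t+1$.
   Context: All graphs are finite, simple and undirected. A harmonious coloring of a graph $G$ with $k$ colors is a proper vertex coloring $c : V(G) \to \{1,\dots,k\}$ such that for every two distinct colors $i,j$ there is at most one pair of adjacent vertices colored with $i$ and $j$. The harmonious chromatic number $h(G)$ is the minimum positive integer $k$ for which $G$ has a harmonious coloring with $k$ colors. For $n\ge 3$ and $m\ge 2$, the lollipop graph $L_{n,m}$ is obtained from the disjoint union of the complete graph $K_n$ and the path $P_m$ with $m$ vertices by identifying a vertex $u$ of $K_n$ with a degree-$1$ vertex $v$ (an endpoint) of $P_m$; thus $L_{n,m}$ has $n+m-1$ vertices and $\frac{n(n-1)}{2}+m-1$ edges. -}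

module Defs where

open import Data.Nat.Base using (ℕ; zero; suc; _+_; _*_; _∸_; _/_; _⊔_; _≤_)
open import Data.Nat.Properties using (1+n≢n) renaming (_≟_ to _≟ℕ_)
open import Data.Nat.Divisibility using (_∣_; _∤_)
open import Data.Fin.Base using (Fin; zero; suc; toℕ)
open import Data.Fin.Properties using (_≟_; any?; +↔⊎)
open import Data.Product.Base using (Σ; ∃₂; _×_; _,_)
open import Data.Sum.Base as Sum using (_⊎_; inj₁; inj₂; swap)
open import Data.Sum.Properties using (≡-dec; inj₁-injective; inj₂-injective)
open import Function.Bundles using (_↔_)
open import Function.Construct.Identity using (↔-id)
open import Function.Construct.Symmetry using (↔-sym)
open import Level using (0ℓ)
open import Relation.Binary.Construct.Union using (_∪_)
open import Relation.Binary.Core using (Rel)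
open import Relation.Binary.Definitions
  using (Symmetric; Irreflexive; Decidable; DecidableEquality)
open import Relation.Binary.PropositionalEquality
  using (_≡_; _≢_; refl; sym; trans; cong; ≢-sym)
open import Relation.Nullary.Decidable using (¬?; _×-dec_; _⊎-dec_)

Least : (ℕ → Set) → ℕ → Set
Least P k = P k × (∀ j → P j → k ≤ j)

record Graph : Set₁ where
  field
    Vertex     : Set
    Adj        : Rel Vertex 0ℓ
    order      : ℕ
    finite     : Vertex ↔ Fin order
    adj-sym    : Symmetric Adj
    adj-irrefl : Irreflexive _≡_ Adj
    adj?       : Decidable Adj

open Graph

Coloring : Graph → ℕ → Set
Coloring G k = Vertex G → Fin k

Proper : (G : Graph) {k : ℕ} → Coloring G k → Set
Proper G c = ∀ {x y} → Adj G x y → c x ≢ c y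

-- Two edges joining colour i to colour j are compared with both oriented
-- from i to j; as i ≢ j, they are then the same unordered pair exactly when
-- they agree endpoint by endpoint.
PairwiseUnique : (G : Graph) {k : ℕ} → Coloring G k → Set
PairwiseUnique G c =
  ∀ {i j} → i ≢ j →
  ∀ {x y x′ y′} →
  Adj G x y → c x ≡ i → c y ≡ j →
  Adj G x′ y′ → c x′ ≡ i → c y′ ≡ j →
  x ≡ x′ × y ≡ y′

IsHarmonious : (G : Graph) {k : ℕ} → Coloring G k → Set
IsHarmonious G c = Proper G c × PairwiseUnique G c

HarmoniouslyColorable : Graph → ℕ → Set
HarmoniouslyColorable G k = Σ (Coloring G k) (IsHarmonious G)

-- h[ G ]≡ k is the graph of the function G ↦ h(G).
h[_]≡_ : Graph → ℕ → Set
h[ G ]≡ k = Least (λ j → 1 ≤ j × HarmoniouslyColorable G j) k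

infix 4 h[_]≡_

complete : ℕ → Graph
complete n = record
  { Vertex     = Fin n
  ; Adj        = _≢_
  ; order      = n
  ; finite     = ↔-id (Fin n)
  ; adj-sym    = ≢-sym
  ; adj-irrefl = λ x≡y x≢y → x≢y x≡y
  ; adj?       = λ x y → ¬? (x ≟ y)
  }

path : ℕ → Graph
path m = record
  { Vertex     = Fin m
  ; Adj        = λ x y → toℕ y ≡ suc (toℕ x) ⊎ toℕ x ≡ suc (toℕ y)
  ; order      = m
  ; finite     = ↔-id (Fin m)
  ; adj-sym    = swap
  ; adj-irrefl = λ { refl (inj₁ e) → 1+n≢n (sym e)
                   ; refl (inj₂ e) → 1+n≢n (sym e) }
  ; adj?       = λ x y → (toℕ y ≟ℕ suc (toℕ x)) ⊎-dec (toℕ x ≟ℕ suc (toℕ y))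
  }

Image : {A B : Set} → (A → B) → Rel A 0ℓ → Rel B 0ℓ
Image f R x y = ∃₂ λ a b → R a b × f a ≡ x × f b ≡ y

-- Identifying u with the endpoint zero of the path leaves all of Fin n and
-- the remaining m ∸ 1 path vertices.  The restriction of the quotient map to
-- K_n is inj₁, and its restriction to P_m is glue u.
LollipopVertex : ℕ → ℕ → Set
LollipopVertex n m = Fin n ⊎ Fin (m ∸ 1)

glue : ∀ {n m} → Fin n → Fin m → LollipopVertex n m
glue u zero    = inj₁ u
glue u (suc j) = inj₂ j

glue-injective : ∀ {n m} (u : Fin n) {a b : Fin m} → glue u a ≡ glue u b → a ≡ b
glue-injective u {zero}  {zero}  _ = refl
glue-injective u {suc a} {suc b} e = cong suc (inj₂-injective e)

module _ (G : Graph) {B : Set} (f : Vertex G → B) where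

  image-sym : Symmetric (Image f (Adj G))
  image-sym (a , b , r , p , q) = b , a , adj-sym G r , q , p

  image-irrefl : (∀ {a b} → f a ≡ f b → a ≡ b) → Irreflexive _≡_ (Image f (Adj G))
  image-irrefl inj x≡y (a , b , r , p , q) =
    adj-irrefl G (inj (trans p (trans x≡y (sym q)))) r

image? : ∀ {k} {B : Set} (f : Fin k → B) {R : Rel (Fin k) 0ℓ} →
         DecidableEquality B → Decidable R → Decidable (Image f R)
image? f _≟B_ R? x y =
  any? λ a → any? λ b → R? a b ×-dec (f a ≟B x) ×-dec (f b ≟B y)

lollipop : (n m : ℕ) → Fin n → Graph
lollipop n m u = record
  { Vertex     = LollipopVertex n m
  ; Adj        = Image inj₁ (Adj (complete n)) ∪ Image (glue u) (Adj (path m))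
  ; order      = n + (m ∸ 1)
  ; finite     = ↔-sym +↔⊎
  ; adj-sym    = Sum.map (image-sym (complete n) inj₁) (image-sym (path m) (glue u))
  ; adj-irrefl = λ where
      x≡y (inj₁ e) → image-irrefl (complete n) inj₁ inj₁-injective x≡y e
      x≡y (inj₂ e) → image-irrefl (path m) (glue u) (glue-injective u) x≡y e
  ; adj?       = λ x y → image? inj₁ (≡-dec _≟_ _≟_) (adj? (complete n)) x y
                   ⊎-dec image? (glue u) (≡-dec _≟_ _≟_) (adj? (path m)) x y
  }

bound : ℕ → ℕ → ℕ
bound n t = 1 + n * t + t * (t ∸ 1) / 2

-- For 3 ≤ n and 1 ≤ t no quantity subtracted from bound n t exceeds it, and
-- t * (t ∸ 1), t in the second case, and t - (n - 2) in the last case are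
-- even, so all halves are exact.  In the last case, a negative t - (n - 2) is
-- truncated to 0 by ∸, in agreement with the maximum with 0.  Finally, t ≥ 1
-- whenever t is the least natural number with m ≤ bound n t and 2 ≤ m.
ColorableCase : (n m t : ℕ) → Set
ColorableCase n m t =
    (2 ∣ t × 2 ∤ n)
  ⊎ (2 ∣ t × 2 ∣ n × m ≤ bound n t ∸ t / 2)
  ⊎ (2 ∤ t × 2 ∣ n × m ≤ bound n t ∸ (n ∸ 2))
  ⊎ (2 ∤ t × 2 ∤ n × m ≤ bound n t ∸ ((n ∸ 2) + ((t ∸ (n ∸ 2)) / 2 ⊔ 0)))

{-# OPTIONS --safe #-}

-- The clique uses n colours and every pair of them, so a harmonious colouring
-- with n + s colours is a trail with m - 1 edges in the graph H obtained by
-- joining n independent vertices to K_s, starting at one of the n.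
--
-- Upper bound on the length of a trail: H has n s + s (s - 1) / 2 edges, and
-- only the two ends of a trail may have odd degree in it, so every other
-- vertex of odd degree in H is missed by at least one of its edges.
--
-- Long trails: passing from s to s + 2 adds two vertices a and b, and their
-- edges (apart from ab when n + s is even) form a closed trail at the starting
-- vertex, which is put in front of the trail already there.  When n and s are
-- odd and s + 2 ≤ n - 2 the edge ab must be used too; the closed trail then
-- swaps two of its edges for two edges not used so far.
module Submission where

open import Defs
open import Data.Fin.Base using (Fin; zero; suc; toℕ; fromℕ; fromℕ<; inject₁; inject≤)
open import Data.Fin.Permutation as Perm using (_⟨$⟩ʳ_; _⟨$⟩ˡ_)
open import Data.Fin.Properties
  using (toℕ-injective; toℕ-inject₁; toℕ<n; toℕ-fromℕ<; toℕ-inject≤; injective⇒≤; suc-injective)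
  renaming (_≟_ to _≟F_)
open import Data.List.Base using (List; []; _∷_; length; take; lookup)
open import Data.List.Membership.Propositional.Properties using (∈-lookup)
open import Data.List.Properties using (length-take)
open import Data.List.Relation.Unary.All as All using (All; []; _∷_)
import Data.List.Relation.Unary.All.Properties as All
open import Data.List.Relation.Unary.AllPairs using ([]; _∷_)
open import Data.List.Relation.Unary.Unique.Propositional using (Unique)
open import Data.List.Relation.Unary.Unique.Propositional.Properties using (take⁺)
open import Data.Nat.Base
open import Data.Nat.DivMod using (m*n/n≡m)
open import Data.Nat.Divisibility using (_∣_; _∤_; divides)
open import Data.Nat.Properties hiding (suc-injective)
open import Data.Nat.Tactic.RingSolver using (solve-∀)
open import Data.Product.Base using (∃-syntax; _×_; _,_; proj₁; proj₂)
open import Data.Sum.Base using (_⊎_; inj₁; inj₂)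
open import Function.Base using (_∘_)
open import Level using (0ℓ)
open import Relation.Binary.PropositionalEquality
open import Relation.Nullary using (¬_; yes; no; contradiction)
open import Relation.Nullary.Negation.Core using () renaming (_¬-⊎_ to ¬∪)
open import Relation.Unary using (Pred; _∪_; ｛_｝; _⊆_)
open import Algebra.Properties.Semiring.Sum +-*-semiring
  using (sum; sum-cong-≗; ∑-distrib-+; ∑-comm; *-distribˡ-sum; *-distribʳ-sum; sum-init-last)

open Graph

-- Counting the edges of a trail

∑-mono-≤ : ∀ {k} {f g : Fin k → ℕ} → (∀ i → f i ≤ g i) → sum f ≤ sum g
∑-mono-≤ {zero}  f≤g = z≤n
∑-mono-≤ {suc k} f≤g = +-mono-≤ (f≤g zero) (∑-mono-≤ (f≤g ∘ suc))

∑-const : ∀ k c → sum {k} (λ _ → c) ≡ k * c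
∑-const zero    c = refl
∑-const (suc k) c = cong (c +_) (∑-const k c)

∑-zero : ∀ {k} {f : Fin k → ℕ} → (∀ i → f i ≡ 0) → sum f ≡ 0
∑-zero {zero}  f≡0 = refl
∑-zero {suc k} f≡0 = cong₂ _+_ (f≡0 zero) (∑-zero (f≡0 ∘ suc))

term≤∑ : ∀ {k} (f : Fin k → ℕ) i → f i ≤ sum f
term≤∑ f zero    = m≤m+n _ _
term≤∑ f (suc i) = ≤-trans (term≤∑ (f ∘ suc) i) (m≤n+m _ (f zero))

∑≢0⇒∃≢0 : ∀ {k} (f : Fin k → ℕ) → sum f ≢ 0 → ∃[ i ] f i ≢ 0
∑≢0⇒∃≢0 {zero}  f ne = contradiction refl ne
∑≢0⇒∃≢0 {suc k} f ne with f zero ≟ 0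
... | no  f₀≢0 = zero , f₀≢0
... | yes f₀≡0 =
  let i , fᵢ≢0 = ∑≢0⇒∃≢0 (f ∘ suc) (λ z → ne (cong₂ _+_ f₀≡0 z)) in suc i , fᵢ≢0

-- Turns injectivity of `c₀` and the trail condition into the bounds `χ≤1` and `e≤1`.
∑≤1 : ∀ {k} (f : Fin k → ℕ) → (∀ i → f i ≤ 1) →
      (∀ i j → f i ≢ 0 → f j ≢ 0 → i ≡ j) → sum f ≤ 1
∑≤1 {zero}  f f≤1 uniq = z≤n
∑≤1 {suc k} f f≤1 uniq with f zero ≟ 0 | sum (f ∘ suc) ≟ 0
... | no  f₀≢0 | no  ne   =
  let i , fᵢ≢0 = ∑≢0⇒∃≢0 (f ∘ suc) ne in contradiction (uniq zero (suc i) f₀≢0 fᵢ≢0) λ ()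
... | no  _    | yes z    rewrite z | +-identityʳ (f zero) = f≤1 zero
... | yes f₀≡0 | _        rewrite f₀≡0 =
  ∑≤1 (f ∘ suc) (f≤1 ∘ suc) (λ i j p q → suc-injective (uniq (suc i) (suc j) p q))

-- The Kronecker delta: with it visits, degrees and edge counts become double sums, which `∑-comm`
-- can reorder.
δ : ∀ {k} → Fin k → Fin k → ℕ
δ x y with x ≟F y
... | yes _ = 1
... | no  _ = 0

δ≤1 : ∀ {k} (x y : Fin k) → δ x y ≤ 1
δ≤1 x y with x ≟F y
... | yes _ = ≤-refl
... | no  _ = z≤n

δ≢0⇒≡ : ∀ {k} {x y : Fin k} → δ x y ≢ 0 → x ≡ y
δ≢0⇒≡ {x = x} {y} ne with x ≟F y
... | yes x≡y = x≡y
... | no  _   = contradiction refl ne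

≢⇒δ≡0 : ∀ {k} {x y : Fin k} → x ≢ y → δ x y ≡ 0
≢⇒δ≡0 {x = x} {y} x≢y with x ≟F y
... | yes x≡y = contradiction x≡y x≢y
... | no  _   = refl

δ-refl : ∀ {k} (x : Fin k) → δ x x ≡ 1
δ-refl x with x ≟F x
... | yes _   = refl
... | no  x≢x = contradiction refl x≢x

δ-suc : ∀ {k} (x y : Fin k) → δ (suc x) (suc y) ≡ δ x y
δ-suc x y with x ≟F y
... | yes _ = refl
... | no  _ = refl

∑-δ : ∀ {k} (x : Fin k) (f : Fin k → ℕ) → sum (λ y → f y * δ x y) ≡ f x
∑-δ zero f = begin
  f zero * 1 + sum (λ y → f (suc y) * 0)
    ≡⟨ cong₂ _+_ (*-identityʳ (f zero)) (∑-zero (λ y → *-zeroʳ (f (suc y)))) ⟩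
  f zero + 0                              ≡⟨ +-identityʳ _ ⟩
  f zero                                  ∎
  where open ≡-Reasoning
∑-δ (suc x) f =
  trans (cong₂ _+_ (*-zeroʳ (f zero)) (sum-cong-≗ (λ y → cong (f (suc y) *_) (δ-suc x y))))
        (∑-δ x (f ∘ suc))

∑-δ₁ : ∀ {k} (x : Fin k) → sum (δ x) ≡ 1
∑-δ₁ x = trans (sum-cong-≗ (λ y → sym (*-identityˡ (δ x y)))) (∑-δ x (λ _ → 1))

*≢0ˡ : ∀ {a b} → a * b ≢ 0 → a ≢ 0
*≢0ˡ ne refl = ne refl

*≢0ʳ : ∀ a {b} → a * b ≢ 0 → b ≢ 0
*≢0ʳ a ne refl = ne (*-zeroʳ a)

≤1-cases : ∀ {a} → a ≤ 1 → a ≡ 0 ⊎ a ≡ 1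
≤1-cases z≤n       = inj₁ refl
≤1-cases (s≤s z≤n) = inj₂ refl

odd≢even : ∀ a b → 1 + 2 * a ≢ 2 * b
odd≢even a b e = even≢odd b a (sym e)

-- If a + c is even, then a cannot attain an odd bound unless c > 0.
odd-bound : ∀ {a s} c o r → a + c ≡ 2 * o → s ≡ 1 + 2 * r → a ≤ s → a + 1 ≤ s + c
odd-bound {a} {s} zero o r even odd a≤s = begin
  a + 1     ≡⟨ +-comm a 1 ⟩
  suc a     ≤⟨ ≤∧≢⇒< a≤s (λ a≡s → odd≢even r o
                 (trans (sym odd) (trans (sym a≡s) (trans (sym (+-identityʳ a)) even)))) ⟩
  s         ≡⟨ +-identityʳ s ⟨
  s + 0     ∎
  where open ≤-Reasoning
odd-bound (suc c) _ _ _ _ a≤s = +-mono-≤ a≤s (s≤s z≤n)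

-- A walk p of length ℓ in the complete graph on the colours that uses every
-- edge at most once and no edge within the image of c₀.
module _ {n s k ℓ : ℕ} (k≡n+s : k ≡ n + s)
  (c₀ : Fin n → Fin k) (c₀-inj : ∀ {i j} → c₀ i ≡ c₀ j → i ≡ j)
  (p : Fin (suc ℓ) → Fin k) (start : ∃[ i ] c₀ i ≡ p zero)
  (steps : ∀ i → p (inject₁ i) ≢ p (suc i))
  (trail : ∀ i j →
    (p (inject₁ i) ≡ p (inject₁ j) × p (suc i) ≡ p (suc j)) ⊎
    (p (inject₁ i) ≡ p (suc j) × p (suc i) ≡ p (inject₁ j)) → i ≡ j)
  (avoids : ∀ i a b → c₀ a ≡ p (inject₁ i) → c₀ b ≢ p (suc i))
  where

  private
    l r : Fin ℓ → Fin k
    l i = p (inject₁ i)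
    r i = p (suc i)

    pe : Fin k
    pe = p (fromℕ ℓ)

    -- Indicators of the image of `c₀` (the clique colours) and of its complement, used as weights
    -- that split sums over all colours.
    χ τ : Fin k → ℕ
    χ x = sum (λ i → δ (c₀ i) x)
    τ x = 1 ∸ χ x

    χ≤1 : ∀ x → χ x ≤ 1
    χ≤1 x = ∑≤1 _ (λ i → δ≤1 (c₀ i) x)
      (λ i j p q → c₀-inj (trans (δ≢0⇒≡ p) (sym (δ≢0⇒≡ q))))

    χ+τ : ∀ x → χ x + τ x ≡ 1
    χ+τ x = m+[n∸m]≡n (χ≤1 x)

    ∑χ : sum χ ≡ n
    ∑χ = begin
      sum χ                           ≡⟨ ∑-comm (λ x i → δ (c₀ i) x) ⟩
      sum (λ i → sum (δ (c₀ i)))      ≡⟨ sum-cong-≗ (λ i → ∑-δ₁ (c₀ i)) ⟩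
      sum {n} (λ _ → 1)               ≡⟨ ∑-const n 1 ⟩
      n * 1                           ≡⟨ *-identityʳ n ⟩
      n                               ∎
      where open ≡-Reasoning

    ∑τ : sum τ ≡ s
    ∑τ = +-cancelˡ-≡ n _ _ (begin
      n + sum τ                ≡⟨ cong (_+ sum τ) ∑χ ⟨
      sum χ + sum τ            ≡⟨ ∑-distrib-+ χ τ ⟨
      sum (λ x → χ x + τ x)    ≡⟨ sum-cong-≗ χ+τ ⟩
      sum {k} (λ _ → 1)        ≡⟨ ∑-const k 1 ⟩
      k * 1                    ≡⟨ *-identityʳ k ⟩
      k                        ≡⟨ k≡n+s ⟩
      n + s                    ∎)
      where open ≡-Reasoning

    χ≢0⇒∃ : ∀ {x} → χ x ≢ 0 → ∃[ i ] c₀ i ≡ x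
    χ≢0⇒∃ ne = let i , q = ∑≢0⇒∃≢0 _ ne in i , δ≢0⇒≡ q

    χ-start : χ (p zero) ≡ 1
    χ-start = ≤-antisym (χ≤1 _) (let i , cᵢ≡p₀ = start in
      subst (λ x → 1 ≤ χ x) cᵢ≡p₀
        (≤-trans (≤-reflexive (sym (δ-refl (c₀ i)))) (term≤∑ (λ j → δ (c₀ j) (c₀ i)) i)))

    step : Fin k → Fin k → Fin ℓ → ℕ
    step x y i = δ (l i) x * δ (r i) y + δ (l i) y * δ (r i) x

    -- The adjacency matrix of the trail.
    e : Fin k → Fin k → ℕ
    e x y = sum (step x y)

    e-sym : ∀ x y → e x y ≡ e y x
    e-sym x y = sum-cong-≗ (λ i → +-comm (δ (l i) x * δ (r i) y) _)

    step≢0 : ∀ {x y i} → step x y i ≢ 0 → (l i ≡ x × r i ≡ y) ⊎ (l i ≡ y × r i ≡ x)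
    step≢0 {x} {y} {i} ne with δ (l i) x * δ (r i) y ≟ 0
    ... | no  q = inj₁ (δ≢0⇒≡ (*≢0ˡ q) , δ≢0⇒≡ (*≢0ʳ (δ (l i) x) q))
    ... | yes q = inj₂ (δ≢0⇒≡ (*≢0ˡ q′) , δ≢0⇒≡ (*≢0ʳ (δ (l i) y) q′))
      where q′ = λ z → ne (cong₂ _+_ q z)

    e≢0 : ∀ {x y} → e x y ≢ 0 → ∃[ i ] ((l i ≡ x × r i ≡ y) ⊎ (l i ≡ y × r i ≡ x))
    e≢0 {x} {y} ne = let i , q = ∑≢0⇒∃≢0 (step x y) ne in i , step≢0 q

    e-diag : ∀ x → e x x ≡ 0
    e-diag x with e x x ≟ 0
    ... | yes eq = eq
    ... | no  ne with e≢0 {x} {x} ne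
    ... | i , inj₁ (a , b) = contradiction (trans a (sym b)) (steps i)
    ... | i , inj₂ (a , b) = contradiction (trans a (sym b)) (steps i)

    step≤1 : ∀ x y i → x ≢ y → step x y i ≤ 1
    step≤1 x y i x≢y with l i ≟F x | l i ≟F y
    ... | yes a | yes b = contradiction (trans (sym a) b) x≢y
    ... | yes _ | no  _ = ≤-trans (≤-reflexive (trans (+-identityʳ _) (+-identityʳ _))) (δ≤1 (r i) y)
    ... | no  _ | yes _ = ≤-trans (≤-reflexive (+-identityʳ _)) (δ≤1 (r i) x)
    ... | no  _ | no  _ = z≤n

    e≤1 : ∀ {x y} → x ≢ y → e x y ≤ 1
    e≤1 {x} {y} x≢y = ∑≤1 (step x y) (λ i → step≤1 x y i x≢y) uniq
      where
      uniq : ∀ i j → step x y i ≢ 0 → step x y j ≢ 0 → i ≡ j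
      uniq i j p q with step≢0 p | step≢0 q
      ... | inj₁ (a , b) | inj₁ (c , d) = trail i j (inj₁ (trans a (sym c) , trans b (sym d)))
      ... | inj₁ (a , b) | inj₂ (c , d) = trail i j (inj₂ (trans a (sym d) , trans b (sym c)))
      ... | inj₂ (a , b) | inj₁ (c , d) = trail i j (inj₂ (trans a (sym d) , trans b (sym c)))
      ... | inj₂ (a , b) | inj₂ (c , d) = trail i j (inj₁ (trans a (sym c) , trans b (sym d)))

    -- As there are no loops, the diagonal has room for `δ`. A row then sums to the degree plus one,
    -- which avoids subtraction in the degree bounds.
    e+δ≤1 : ∀ x y → e x y + δ x y ≤ 1
    e+δ≤1 x y with x ≟F y
    ... | yes refl rewrite e-diag x = ≤-refl
    ... | no  x≢y = ≤-trans (≤-reflexive (+-identityʳ _)) (e≤1 x≢y)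

    e-avoids : ∀ {x y} → χ x ≡ 1 → χ y ≡ 1 → e x y ≡ 0
    e-avoids {x} {y} χx χy with e x y ≟ 0
    ... | yes eq = eq
    ... | no  ne with χ≢0⇒∃ {x} (λ z → 0≢1+n (trans (sym z) χx))
                    | χ≢0⇒∃ {y} (λ z → 0≢1+n (trans (sym z) χy)) | e≢0 {x} {y} ne
    ... | a , refl | b , refl | i , inj₁ (u , v) = contradiction (sym v) (avoids i a b (sym u))
    ... | a , refl | b , refl | i , inj₂ (u , v) = contradiction (sym v) (avoids i b a (sym u))

    τ⇐χ0 : ∀ {x} → χ x ≡ 0 → τ x ≡ 1
    τ⇐χ0 eq rewrite eq = refl

    τ⇐χ1 : ∀ {x} → χ x ≡ 1 → τ x ≡ 0
    τ⇐χ1 eq rewrite eq = refl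

    d : Fin k → ℕ
    d x = sum (e x)

    d-ends : ∀ x → d x ≡ sum (λ i → δ (l i) x) + sum (λ i → δ (r i) x)
    d-ends x = begin
      sum (λ y → sum (step x y))       ≡⟨ ∑-comm (step x) ⟩
      sum (λ i → sum (λ y → step x y i))
        ≡⟨ sum-cong-≗ (λ i → trans (∑-distrib-+ (λ y → δ (l i) x * δ (r i) y) _)
             (cong₂ _+_ (∑-δ (r i) (λ _ → δ (l i) x))
               (trans (sum-cong-≗ (λ y → *-comm (δ (l i) y) (δ (r i) x)))
                      (∑-δ (l i) (λ _ → δ (r i) x))))) ⟩
      sum (λ i → δ (l i) x + δ (r i) x)  ≡⟨ ∑-distrib-+ (λ i → δ (l i) x) _ ⟩
      sum (λ i → δ (l i) x) + sum (λ i → δ (r i) x)  ∎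
      where open ≡-Reasoning

    -- `L` counts the visits to `x` that are left again and `R` those that are arrived at. Only the
    -- last vertex is not left and only the first is not arrived at, so adding both ends counts
    -- every visit twice.
    d-even : ∀ x → d x + (δ (p zero) x + δ pe x) ≡ 2 * sum (λ i → δ (p i) x)
    d-even x = begin
      d x + (δ (p zero) x + δ pe x)     ≡⟨ cong (_+ (δ (p zero) x + δ pe x)) (d-ends x) ⟩
      (L + R) + (δ (p zero) x + δ pe x) ≡⟨ regroup L R _ _ ⟩
      (L + δ pe x) + (δ (p zero) x + R) ≡⟨ cong (_+ (δ (p zero) x + R)) (sum-init-last (λ i → δ (p i) x)) ⟨
      O + O                             ≡⟨ cong (O +_) (+-identityʳ O) ⟨
      2 * O                             ∎
      where
      open ≡-Reasoning
      regroup : ∀ a b c d → (a + b) + (c + d) ≡ (a + d) + (c + b)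
      regroup = solve-∀
      L = sum (λ i → δ (l i) x)
      R = sum (λ i → δ (r i) x)
      O = sum (λ i → δ (p i) x)

    -- The handshake identity for the degrees `d`.
    ∑d : sum d ≡ 2 * ℓ
    ∑d = begin
      sum d ≡⟨ sum-cong-≗ d-ends ⟩
      sum (λ x → sum (λ i → δ (l i) x) + sum (λ i → δ (r i) x))
        ≡⟨ ∑-distrib-+ (λ x → sum (λ i → δ (l i) x)) _ ⟩
      sum (λ x → sum (λ i → δ (l i) x)) + sum (λ x → sum (λ i → δ (r i) x))
        ≡⟨ cong₂ _+_ (one l) (one r) ⟩
      ℓ + ℓ ≡⟨ cong (ℓ +_) (+-identityʳ ℓ) ⟨
      2 * ℓ ∎
      where
      open ≡-Reasoning
      one : (f : Fin ℓ → Fin k) → sum (λ x → sum (λ i → δ (f i) x)) ≡ ℓ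
      one f = trans (∑-comm (λ x i → δ (f i) x))
                (trans (sum-cong-≗ (λ i → ∑-δ₁ (f i))) (trans (∑-const ℓ 1) (*-identityʳ ℓ)))

    ∑-*-mono : ∀ (w : Fin k → ℕ) {f g : Fin k → ℕ} → (∀ x → w x ≡ 1 → f x ≤ g x) → (∀ x → w x ≤ 1) →
               sum (λ x → w x * f x) ≤ sum (λ x → w x * g x)
    ∑-*-mono w {f} {g} h w≤1 = ∑-mono-≤ {f = λ x → w x * f x} {λ x → w x * g x} (λ x → go x (≤1-cases (w≤1 x)))
      where
      go : ∀ x → w x ≡ 0 ⊎ w x ≡ 1 → w x * f x ≤ w x * g x
      go x (inj₁ eq) rewrite eq = z≤n
      go x (inj₂ eq) = *-monoʳ-≤ (w x) (h x eq)

    τ≤1 : ∀ x → τ x ≤ 1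
    τ≤1 x = m∸n≤m 1 (χ x)

    -- Degree sums over the clique colours and over the others. As no step joins two clique colours,
    -- `A` is also the number of steps that meet one.
    A B : ℕ
    A = sum (λ x → χ x * d x)
    B = sum (λ x → τ x * d x)

    A+B : A + B ≡ 2 * ℓ
    A+B = begin
      A + B                              ≡⟨ ∑-distrib-+ (λ x → χ x * d x) _ ⟨
      sum (λ x → χ x * d x + τ x * d x)  ≡⟨ sum-cong-≗ (λ x →
        trans (sym (*-distribʳ-+ (d x) (χ x) (τ x)))
          (trans (cong (_* d x) (χ+τ x)) (*-identityˡ (d x)))) ⟩
      sum d                              ≡⟨ ∑d ⟩
      2 * ℓ                              ∎
      where open ≡-Reasoning

    ∑w*+ : ∀ (w f : Fin k → ℕ) c → sum (λ x → w x * (f x + c)) ≡ sum (λ x → w x * f x) + sum w * c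
    ∑w*+ w f c = begin
      sum (λ x → w x * (f x + c))        ≡⟨ sum-cong-≗ (λ x → *-distribˡ-+ (w x) (f x) c) ⟩
      sum (λ x → w x * f x + w x * c)    ≡⟨ ∑-distrib-+ (λ x → w x * f x) _ ⟩
      sum (λ x → w x * f x) + sum (λ x → w x * c)
        ≡⟨ cong (sum (λ x → w x * f x) +_) (*-distribʳ-sum c w) ⟨
      sum (λ x → w x * f x) + sum w * c  ∎
      where open ≡-Reasoning

    -- Adds up local bounds of the kind that `odd-bound` gives: the corrections for the two ends
    -- contribute just the weights of these ends.
    ∑w-ends : ∀ (w : Fin k → ℕ) c →
              sum (λ x → w x * (c + (δ (p zero) x + δ pe x))) ≡ sum w * c + (w (p zero) + w pe)
    ∑w-ends w c = begin
      sum (λ x → w x * (c + (δ (p zero) x + δ pe x)))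
        ≡⟨ sum-cong-≗ (λ x → cong (w x *_) (+-comm c _)) ⟩
      sum (λ x → w x * ((δ (p zero) x + δ pe x) + c)) ≡⟨ ∑w*+ w _ c ⟩
      sum (λ x → w x * (δ (p zero) x + δ pe x)) + sum w * c
        ≡⟨ cong (_+ sum w * c) (trans (sum-cong-≗ (λ x → *-distribˡ-+ (w x) (δ (p zero) x) _))
             (∑-distrib-+ (λ x → w x * δ (p zero) x) _)) ⟩
      (sum (λ x → w x * δ (p zero) x) + sum (λ x → w x * δ pe x)) + sum w * c
        ≡⟨ cong (_+ sum w * c) (cong₂ _+_ (∑-δ (p zero) w) (∑-δ pe w)) ⟩
      (w (p zero) + w pe) + sum w * c ≡⟨ +-comm (w (p zero) + w pe) _ ⟩
      sum w * c + (w (p zero) + w pe) ∎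
      where open ≡-Reasoning

    d≤s : ∀ x → χ x ≡ 1 → d x ≤ s
    d≤s x χx = subst (d x ≤_) ∑τ (∑-mono-≤ λ y → go y (≤1-cases (χ≤1 y)))
      where
      go : ∀ y → χ y ≡ 0 ⊎ χ y ≡ 1 → e x y ≤ τ y
      go y (inj₁ χy) rewrite τ⇐χ0 {y} χy = ≤-trans (m≤m+n _ _) (e+δ≤1 x y)
      go y (inj₂ χy) rewrite e-avoids χx χy = z≤n

    d<k : ∀ x → d x + 1 ≤ k
    d<k x = begin
      d x + 1                      ≡⟨ cong (d x +_) (∑-δ₁ x) ⟨
      d x + sum (δ x)              ≡⟨ ∑-distrib-+ (e x) (δ x) ⟨
      sum (λ y → e x y + δ x y)    ≤⟨ ∑-mono-≤ (e+δ≤1 x) ⟩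
      sum {k} (λ _ → 1)            ≡⟨ ∑-const k 1 ⟩
      k * 1                        ≡⟨ *-identityʳ k ⟩
      k                            ∎
      where open ≤-Reasoning

    A≤ : A ≤ n * s
    A≤ = begin
      A                        ≤⟨ ∑-*-mono χ {d} {λ _ → s} d≤s χ≤1 ⟩
      sum (λ x → χ x * s)      ≡⟨ *-distribʳ-sum s χ ⟨
      sum χ * s                ≡⟨ cong (_* s) ∑χ ⟩
      n * s                    ∎
      where open ≤-Reasoning

    -- Steps between the other colours and the clique colours are counted by `A`. Of the `s * s`
    -- ordered pairs of other colours each carries at most one step, and the diagonal pays for the
    -- added `s`.
    B+s≤ : B + s ≤ A + s * s
    B+s≤ = begin
      B + s                                ≡⟨ cong (B +_) (trans (*-identityʳ (sum τ)) ∑τ) ⟨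
      B + sum τ * 1                        ≡⟨ ∑w*+ τ d 1 ⟨
      sum (λ x → τ x * (d x + 1))          ≡⟨ sum-cong-≗ (λ x → trans
        (cong (τ x *_) (trans (cong (d x +_) (sym (∑-δ₁ x))) (sym (∑-distrib-+ (e x) (δ x)))))
        (*-distribˡ-sum (τ x) (λ y → e x y + δ x y))) ⟩
      sum (λ x → sum (λ y → τ x * (e x y + δ x y)))
        ≤⟨ ∑-mono-≤ (λ x → ∑-mono-≤ (λ y → go x y (≤1-cases (χ≤1 x)) (≤1-cases (χ≤1 y)))) ⟩
      sum (λ x → sum (λ y → χ y * e y x + τ x * τ y))
        ≡⟨ sum-cong-≗ (λ x → trans (∑-distrib-+ (λ y → χ y * e y x) _)
              (cong (sum (λ y → χ y * e y x) +_)
                (trans (sym (*-distribˡ-sum (τ x) τ)) (cong (τ x *_) ∑τ)))) ⟩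
      sum (λ x → sum (λ y → χ y * e y x) + τ x * s)
        ≡⟨ ∑-distrib-+ (λ x → sum (λ y → χ y * e y x)) _ ⟩
      sum (λ x → sum (λ y → χ y * e y x)) + sum (λ x → τ x * s)
        ≡⟨ cong₂ _+_ (trans (∑-comm (λ x y → χ y * e y x))
                        (sum-cong-≗ (λ y → sym (*-distribˡ-sum (χ y) (e y)))))
                     (trans (sym (*-distribʳ-sum s τ)) (cong (_* s) ∑τ)) ⟩
      A + s * s                            ∎
      where
      open ≤-Reasoning
      go : ∀ x y → χ x ≡ 0 ⊎ χ x ≡ 1 → χ y ≡ 0 ⊎ χ y ≡ 1 →
           τ x * (e x y + δ x y) ≤ χ y * e y x + τ x * τ y
      go x y (inj₂ χx) _ rewrite τ⇐χ1 {x} χx = z≤n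
      go x y (inj₁ χx) (inj₁ χy) rewrite χx | χy | +-identityʳ (e x y + δ x y) = e+δ≤1 x y
      go x y (inj₁ χx) (inj₂ χy)
        rewrite χx | χy | +-identityʳ (e x y + δ x y) | +-identityʳ (e y x) | +-identityʳ (e y x)
              | e-sym y x
              | ≢⇒δ≡0 {x = x} {y} (λ { refl → 0≢1+n (trans (sym χx) χy) }) = ≤-reflexive (+-identityʳ _)

    -- For odd `s` a clique colour of degree `s` is an end of the walk, so each one misses an edge
    -- or is paid for by an end. The start is a clique colour; `χ pe` tells whether the last vertex
    -- is one too.
    A+n≤ : ∀ q → s ≡ 1 + 2 * q → A + n ≤ n * s + (1 + χ pe)
    A+n≤ q odd = begin
      A + n                            ≡⟨ cong (A +_) (trans (*-identityʳ (sum χ)) ∑χ) ⟨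
      A + sum χ * 1                    ≡⟨ ∑w*+ χ d 1 ⟨
      sum (λ x → χ x * (d x + 1))      ≤⟨ ∑-*-mono χ {λ x → d x + 1} {λ x → s + (δ (p zero) x + δ pe x)} (λ x χx →
          odd-bound (δ (p zero) x + δ pe x) (sum (λ i → δ (p i) x)) q (d-even x) odd (d≤s x χx)) χ≤1 ⟩
      sum (λ x → χ x * (s + (δ (p zero) x + δ pe x))) ≡⟨ ∑w-ends χ s ⟩
      sum χ * s + (χ (p zero) + χ pe)
        ≡⟨ cong₂ _+_ (cong (_* s) ∑χ) (cong (_+ χ pe) χ-start) ⟩
      n * s + (1 + χ pe)               ∎
      where open ≤-Reasoning

    -- For even `k` the full degree `k - 1` is odd, so a colour attaining it is an end of the walk.
    -- The start is a clique colour, hence only the last vertex can be an exception here.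
    B+2s≤ : ∀ q → k ≡ 2 * q → B + s * 2 ≤ s * k + τ pe
    B+2s≤ q even = begin
      B + s * 2                        ≡⟨ cong (λ z → B + z * 2) ∑τ ⟨
      B + sum τ * 2                    ≡⟨ ∑w*+ τ d 2 ⟨
      sum (λ x → τ x * (d x + 2))      ≤⟨ ∑-mono-≤ (λ x → *-monoʳ-≤ (τ x) (bound′ x)) ⟩
      sum (λ x → τ x * (k + (δ (p zero) x + δ pe x))) ≡⟨ ∑w-ends τ k ⟩
      sum τ * k + (τ (p zero) + τ pe)
        ≡⟨ cong₂ _+_ (cong (_* k) ∑τ) (cong (_+ τ pe) (τ⇐χ1 {p zero} χ-start)) ⟩
      s * k + τ pe                     ∎
      where
      open ≤-Reasoning
      +-comm-2 : ∀ a → a + 2 ≡ 1 + (a + 1)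
      +-comm-2 = solve-∀
      odd′ : ∀ q → 2 * (1 + q) ≡ 1 + (1 + 2 * q)
      odd′ = solve-∀
      bound′ : ∀ x → d x + 2 ≤ k + (δ (p zero) x + δ pe x)
      bound′ x = helper q even
        where
        c = δ (p zero) x + δ pe x
        -- Splitting `q` exhibits the largest degree as the odd number `1 + 2 * q`; for `k ≡ 0`
        -- there is no colour `x`.
        helper : ∀ q → k ≡ 2 * q → d x + 2 ≤ k + c
        helper zero    eq = contradiction (≤-trans (m≤n+m 1 (d x)) (≤-trans (d<k x) (≤-reflexive eq))) λ ()
        helper (suc q) eq = begin
          d x + 2                    ≡⟨ +-comm-2 (d x) ⟩
          1 + (d x + 1)              ≤⟨ s≤s (odd-bound c (sum (λ i → δ (p i) x)) q (d-even x) refl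
             (s≤s⁻¹ (≤-trans (≤-reflexive (+-comm 1 (d x))) (≤-trans (d<k x)
               (≤-reflexive (trans eq (odd′ q))))))) ⟩
          1 + ((1 + 2 * q) + c)      ≡⟨ cong (_+ c) (trans eq (odd′ q)) ⟨
          k + c                      ∎

  -- This is twice the number of edges of H, with `s` moved to the left. `A` occurs twice because
  -- `B` is bounded in terms of it.
  trail-bound : 2 * ℓ + s ≤ 2 * (n * s) + s * s
  trail-bound = begin
    2 * ℓ + s                      ≡⟨ cong (_+ s) A+B ⟨
    A + B + s                      ≡⟨ +-assoc A B s ⟩
    A + (B + s)                    ≤⟨ +-monoʳ-≤ A B+s≤ ⟩
    A + (A + s * s)                ≡⟨ regroup A (s * s) ⟩
    2 * A + s * s                  ≤⟨ +-monoˡ-≤ (s * s) (*-monoʳ-≤ 2 A≤) ⟩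
    2 * (n * s) + s * s            ∎
    where
    open ≤-Reasoning
    regroup : ∀ a b → a + (a + b) ≡ 2 * a + b
    regroup = solve-∀

  -- At most two clique colours are ends, so at least `n - 2` of them miss an edge; these edges are
  -- distinct, as H has none between clique colours.
  trail-bound-odd : ∀ q → s ≡ 1 + 2 * q → 2 * ℓ + s + 2 * n ≤ 2 * (n * s) + s * s + 4
  trail-bound-odd q odd = begin
    2 * ℓ + s + 2 * n              ≡⟨ cong (λ z → z + s + 2 * n) A+B ⟨
    A + B + s + 2 * n              ≡⟨ regroup₁ A B s n ⟩
    (B + s) + (A + 2 * n)          ≤⟨ +-monoˡ-≤ (A + 2 * n) B+s≤ ⟩
    (A + s * s) + (A + 2 * n)      ≡⟨ regroup₂ A s n ⟩
    2 * (A + n) + s * s            ≤⟨ +-monoˡ-≤ (s * s) (*-monoʳ-≤ 2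
       (≤-trans (A+n≤ q odd) (+-monoʳ-≤ (n * s) (s≤s (χ≤1 pe))))) ⟩
    2 * (n * s + 2) + s * s        ≡⟨ regroup₃ n s ⟩
    2 * (n * s) + s * s + 4        ∎
    where
    open ≤-Reasoning
    regroup₁ : ∀ a b s n → a + b + s + 2 * n ≡ (b + s) + (a + 2 * n)
    regroup₁ = solve-∀
    regroup₂ : ∀ a s n → (a + s * s) + (a + 2 * n) ≡ 2 * (a + n) + s * s
    regroup₂ = solve-∀
    regroup₃ : ∀ n s → 2 * (n * s + 2) + s * s ≡ 2 * (n * s) + s * s + 4
    regroup₃ = solve-∀

  -- Here every vertex of H has odd degree. All but at most two miss an edge, and a missed edge
  -- covers at most two vertices. The last vertex is of exactly one kind, so `χ pe` and `τ pe` add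
  -- up to 1.
  trail-bound-odd-even : ∀ q r → s ≡ 1 + 2 * q → k ≡ 2 * r →
                         2 * ℓ + 2 * s + n ≤ 2 * (n * s) + s * s + 2
  trail-bound-odd-even q r odd even = begin
    2 * ℓ + 2 * s + n                             ≡⟨ cong (λ z → z + 2 * s + n) A+B ⟨
    A + B + 2 * s + n                             ≡⟨ regroup A B s n ⟩
    (A + n) + (B + s * 2)                         ≤⟨ +-mono-≤ (A+n≤ q odd) (B+2s≤ r even) ⟩
    (n * s + (1 + χ pe)) + (s * k + τ pe)         ≡⟨ cong (λ z → (n * s + (1 + χ pe)) + (s * z + τ pe)) k≡n+s ⟩
    (n * s + (1 + χ pe)) + (s * (n + s) + τ pe)   ≡⟨ rearrange n s (χ pe) (τ pe) ⟩
    2 * (n * s) + s * s + 1 + (χ pe + τ pe)       ≡⟨ cong (2 * (n * s) + s * s + 1 +_) (χ+τ pe) ⟩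
    2 * (n * s) + s * s + 1 + 1                   ≡⟨ +-assoc (2 * (n * s) + s * s) 1 1 ⟩
    2 * (n * s) + s * s + 2                       ∎
    where
    open ≤-Reasoning
    regroup : ∀ a b s n → a + b + 2 * s + n ≡ (a + n) + (b + s * 2)
    regroup = solve-∀
    rearrange : ∀ n s a b → (n * s + (1 + a)) + (s * (n + s) + b) ≡ 2 * (n * s) + s * s + 1 + (a + b)
    rearrange = solve-∀

  -- The `s` other colours have odd degree in H; at most one of them is an end, and a missed edge
  -- covers at most two of them.
  trail-bound-even : ∀ r → k ≡ 2 * r → 2 * ℓ + 2 * s ≤ 2 * (n * s) + s * s + 1
  trail-bound-even r even = begin
    2 * ℓ + 2 * s                          ≡⟨ cong (_+ 2 * s) A+B ⟨
    A + B + 2 * s                          ≡⟨ regroup₁ A B s ⟩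
    A + (B + s * 2)                        ≤⟨ +-mono-≤ A≤ (≤-trans (B+2s≤ r even) (+-monoʳ-≤ (s * k) (τ≤1 pe))) ⟩
    n * s + (s * k + 1)                    ≡⟨ cong (λ z → n * s + (s * z + 1)) k≡n+s ⟩
    n * s + (s * (n + s) + 1)              ≡⟨ regroup₂ n s ⟩
    2 * (n * s) + s * s + 1                ∎
    where
    open ≤-Reasoning
    regroup₁ : ∀ a b s → a + b + 2 * s ≡ a + (b + s * 2)
    regroup₁ = solve-∀
    regroup₂ : ∀ n s → n * s + (s * (n + s) + 1) ≡ 2 * (n * s) + s * s + 1
    regroup₂ = solve-∀

-- Construction of long trails

Edge : Set
Edge = ℕ × ℕ

-- Colours below n are those of K_n; edges are stored as (smaller , larger).
-- Trails grow at their head, the first index.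
data Walk (n : ℕ) : ℕ → List Edge → Set where
  []   : ∀ {v} → Walk n v []
  up   : ∀ {p q es} → p < q → n ≤ q → Walk n q es → Walk n p ((p , q) ∷ es)
  down : ∀ {p q es} → p < q → n ≤ q → Walk n p es → Walk n q ((p , q) ∷ es)

-- `P` may be larger than the set of edges used: an edge is known to be new once it fails `P`,
-- without inspecting the list.
record Trail (n : ℕ) (P : Pred Edge 0ℓ) (v ℓ : ℕ) : Set where
  constructor mkTrail
  field
    {edges} : List Edge
    walk    : Walk n v edges
    unique  : Unique edges
    within  : All P edges
    len     : length edges ≡ ℓ

weaken : ∀ {n v ℓ} {P Q : Pred Edge 0ℓ} → P ⊆ Q → Trail n P v ℓ → Trail n Q v ℓ
weaken P⊆Q (mkTrail w u a e) = mkTrail w u (All.map P⊆Q a) e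

private
  fresh : ∀ {P : Pred Edge 0ℓ} {e es} → ¬ P e → All P es → All (e ≢_) es
  fresh ¬Pe = All.map (λ { Pf refl → ¬Pe Pf })

  grow : ∀ {P : Pred Edge 0ℓ} {e es} → All P es → All (P ∪ ｛ e ｝) (e ∷ es)
  grow a = inj₂ refl ∷ All.map inj₁ a

ascend : ∀ {n P p q ℓ} → p < q → n ≤ q → ¬ P (p , q) → Trail n P q ℓ →
         Trail n (P ∪ ｛ (p , q) ｝) p (suc ℓ)
ascend p<q n≤q new (mkTrail w u a e) =
  mkTrail (up p<q n≤q w) (fresh new a ∷ u) (grow a) (cong suc e)

descend : ∀ {n P p q ℓ} → p < q → n ≤ q → ¬ P (p , q) → Trail n P p ℓ →
          Trail n (P ∪ ｛ (p , q) ｝) q (suc ℓ)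
descend p<q n≤q new (mkTrail w u a e) =
  mkTrail (down p<q n≤q w) (fresh new a ∷ u) (grow a) (cong suc e)

≢ˡ : ∀ {p q p′ q′ : ℕ} → p ≢ p′ → (p , q) ≢ (p′ , q′)
≢ˡ ne refl = ne refl

≢ʳ : ∀ {p q p′ q′ : ℕ} → q ≢ q′ → (p , q) ≢ (p′ , q′)
≢ʳ ne refl = ne refl

Below Layer : ℕ → Pred Edge 0ℓ
Below N (p , q) = q < N
Layer N (p , q) = N ≤ q × q < 2 + N

-- A block adds the colours N and 1 + N to those below N by a closed trail at 0
-- that visits N, runs through 4-cycles N, y, 1 + N, 1 + y and finally returns.
-- Once the y below i are done, the edges used besides those in O are these.
Done : Pred Edge 0ℓ → (N i : ℕ) → Pred Edge 0ℓ
Done O N i = (O ∪ (λ e → Layer N e × 1 ≤ proj₁ e × proj₁ e < i)) ∪ ｛ (0 , N) ｝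

module Block {n N : ℕ} (n≤N : n ≤ N) where

  private
    n≤1+N : n ≤ 1 + N
    n≤1+N = m≤n⇒m≤1+n n≤N

    N∈ : N ≤ N × N < 2 + N
    N∈ = ≤-refl , m≤n+m (1 + N) 1

    1+N∈ : N ≤ 1 + N × 1 + N < 2 + N
    1+N∈ = n≤1+n N , ≤-refl

  -- `O` may contain edges outside `Below N`, as long as none leads from below `N` to `N` or above.
  -- So after a detour the edge between `N` and `1 + N` can be counted to `O`.
  module _ {O : Pred Edge 0ℓ} (O-low : ∀ {y q} → y < N → N ≤ q → ¬ O (y , q)) where

    not-done : ∀ {i y q} → 1 ≤ i → i ≤ y → y < N → N ≤ q → ¬ Done O N i (y , q)
    not-done 1≤i i≤y y<N N≤q (inj₁ (inj₁ o)) = O-low y<N N≤q o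
    not-done 1≤i i≤y y<N N≤q (inj₁ (inj₂ (_ , _ , y<i))) = <⇒≱ y<i i≤y
    not-done 1≤i i≤y y<N N≤q (inj₂ refl) = <⇒≱ 1≤i i≤y

    done-later : ∀ {i j} → i ≤ j → Done O N i ⊆ Done O N j
    done-later i≤j (inj₁ (inj₁ o)) = inj₁ (inj₁ o)
    done-later i≤j (inj₁ (inj₂ (l , 1≤p , p<i))) = inj₁ (inj₂ (l , 1≤p , <-≤-trans p<i i≤j))
    done-later i≤j (inj₂ eq) = inj₂ eq

    enter : ∀ {ℓ} → 0 < N → Trail n O 0 ℓ → Trail n (Done O N 1) N (1 + ℓ)
    enter 0<N T = weaken sub (descend 0<N n≤N (O-low 0<N ≤-refl) T)
      where
      sub : (O ∪ ｛ (0 , N) ｝) ⊆ Done O N 1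
      sub (inj₁ o)  = inj₁ (inj₁ o)
      sub (inj₂ eq) = inj₂ eq

    cycle : ∀ {i ℓ} → 1 ≤ i → 1 + i < N → Trail n (Done O N i) N ℓ → Trail n (Done O N (2 + i)) N (4 + ℓ)
    cycle {i} 1≤i y′<N T = weaken sub
        -- From the outside in, the trail reads `N`, `i`, `1 + N`, `1 + i`, `N`. Each edge is new
        -- because it is not done and differs in an endpoint from those added before it.
        (descend y<N n≤N (¬∪ (¬∪ (¬∪ (not-done 1≤i ≤-refl y<N ≤-refl) (≢ˡ 1+n≢n)) (≢ˡ 1+n≢n)) (≢ʳ 1+n≢n))
        (ascend (m<n⇒m<1+n y<N) n≤1+N (¬∪ (¬∪ (not-done 1≤i ≤-refl y<N (n≤1+n N)) (≢ˡ 1+n≢n)) (≢ˡ 1+n≢n))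
        (descend (m<n⇒m<1+n y′<N) n≤1+N (¬∪ (not-done 1≤i (n≤1+n i) y′<N (n≤1+n N)) (≢ʳ (1+n≢n ∘ sym)))
        (ascend y′<N n≤N (not-done 1≤i (n≤1+n i) y′<N ≤-refl) T))))
      where
      y<N : i < N
      y<N = <-trans (n<1+n i) y′<N
      now : ∀ {p q} → Layer N (p , q) → i ≤ p → p < 2 + i → Done O N (2 + i) (p , q)
      now l i≤p p<2+i = inj₁ (inj₂ (l , ≤-trans 1≤i i≤p , p<2+i))
      sub : ((((Done O N i ∪ ｛ (1 + i , N) ｝) ∪ ｛ (1 + i , 1 + N) ｝) ∪ ｛ (i , 1 + N) ｝) ∪ ｛ (i , N) ｝)
            ⊆ Done O N (2 + i)
      sub (inj₂ refl)                      = now N∈ ≤-refl (m≤n+m (1 + i) 1)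
      sub (inj₁ (inj₂ refl))               = now 1+N∈ ≤-refl (m≤n+m (1 + i) 1)
      sub (inj₁ (inj₁ (inj₂ refl)))        = now 1+N∈ (n≤1+n i) ≤-refl
      sub (inj₁ (inj₁ (inj₁ (inj₂ refl)))) = now N∈ (n≤1+n i) ≤-refl
      sub (inj₁ (inj₁ (inj₁ (inj₁ d))))    = done-later (m≤n+m i 2) d

    cycles : ∀ m {i ℓ} → 1 ≤ i → 2 * m + i ≤ N → Trail n (Done O N i) N ℓ →
             Trail n (Done O N (2 * m + i)) N (4 * m + ℓ)
    cycles zero 1≤i le T = T
    cycles (suc m) {i} {ℓ} 1≤i le T =
      subst₂ (λ j ℓ′ → Trail n (Done O N j) N ℓ′) (eq₁ m i) (eq₂ m ℓ)
        (cycles m (≤-trans 1≤i (m≤n+m i 2)) le′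
          (cycle 1≤i (≤-trans (m≤n+m (2 + i) (2 * m)) le′) T))
      where
      eq₁ : ∀ m i → 2 * m + (2 + i) ≡ 2 * suc m + i
      eq₁ = solve-∀
      eq₂ : ∀ m ℓ → 4 * m + (4 + ℓ) ≡ 4 * suc m + ℓ
      eq₂ = solve-∀
      le′ = ≤-trans (≤-reflexive (eq₁ m i)) le

    done⇒layer : ∀ {i} → Done O N i ⊆ O ∪ Layer N
    done⇒layer (inj₁ (inj₁ o))       = inj₁ o
    done⇒layer (inj₁ (inj₂ (l , _))) = inj₂ l
    done⇒layer (inj₂ refl)           = inj₂ N∈

    not-0 : 0 < N → ∀ {i} → ¬ Done O N i (0 , 1 + N)
    not-0 0<N (inj₁ (inj₁ o)) = O-low 0<N (n≤1+n N) o
    not-0 0<N (inj₁ (inj₂ (_ , () , _)))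

    -- For odd `N`: the colours from 1 to `N - 1` pair up into 4-cycles, and the way back is `N`,
    -- `1 + N`, 0.
    leave-via-edge : ∀ {i ℓ} → 1 ≤ N → (∀ {q} → N ≤ q → ¬ O (N , q)) → i ≤ N →
                     Trail n (Done O N i) N ℓ → Trail n (O ∪ Layer N) 0 (2 + ℓ)
    leave-via-edge {i} 1≤N O-N i≤N T = weaken sub
        (ascend (s≤s z≤n) n≤1+N (¬∪ (not-0 1≤N) (≢ˡ (>⇒≢ 1≤N)))
        (descend (n<1+n N) n≤1+N new T))
      where
      new : ¬ Done O N i (N , 1 + N)
      new (inj₁ (inj₁ o)) = O-N (n≤1+n N) o
      new (inj₁ (inj₂ (_ , _ , N<i))) = <⇒≱ N<i i≤N
      sub : ((Done O N i ∪ ｛ (N , 1 + N) ｝) ∪ ｛ (0 , 1 + N) ｝) ⊆ O ∪ Layer N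
      sub (inj₁ (inj₁ d))    = done⇒layer d
      sub (inj₁ (inj₂ refl)) = inj₂ 1+N∈
      sub (inj₂ refl)        = inj₂ 1+N∈

    -- For even `N`: the colour `N - 1` remains unpaired and lies on the way back, which is `N`,
    -- `z`, `1 + N`, 0.
    leave-via-vertex : ∀ {z ℓ} → N ≡ 1 + z → 1 ≤ z →
                       Trail n (Done O N z) N ℓ → Trail n (O ∪ Layer N) 0 (3 + ℓ)
    leave-via-vertex {z} refl 1≤z T = weaken sub
        (ascend (s≤s z≤n) n≤1+N (¬∪ (¬∪ (not-0 (s≤s z≤n)) (≢ˡ (<⇒≢ 1≤z ∘ sym))) (≢ˡ (<⇒≢ 1≤z ∘ sym)))
        (descend (m≤n+m (1 + z) 1) n≤1+N (¬∪ (not-done 1≤z ≤-refl ≤-refl (n≤1+n N)) (≢ʳ (1+n≢n ∘ sym)))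
        (ascend ≤-refl n≤N (not-done 1≤z ≤-refl ≤-refl ≤-refl) T)))
      where
      sub : (((Done O N z ∪ ｛ (z , N) ｝) ∪ ｛ (z , 1 + N) ｝) ∪ ｛ (0 , 1 + N) ｝) ⊆ O ∪ Layer N
      sub (inj₁ (inj₁ (inj₁ d)))    = done⇒layer d
      sub (inj₁ (inj₁ (inj₂ refl))) = inj₂ N∈
      sub (inj₁ (inj₂ refl))        = inj₂ 1+N∈
      sub (inj₂ refl)               = inj₂ 1+N∈

    -- Instead of a 4-cycle, go N, 1 + x, n, x, 1 + N, N: this spends the edge
    -- between N and 1 + N and two edges at n left over by earlier blocks.
    detour : ∀ {x ℓ} → 1 ≤ x → 1 + x < n → n < N → ¬ O (x , n) → ¬ O (1 + x , n) →
             (∀ {q} → N ≤ q → ¬ O (N , q)) →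
             Trail n (Done O N x) N ℓ →
             Trail n (Done (((O ∪ ｛ (x , n) ｝) ∪ ｛ (1 + x , n) ｝) ∪ ｛ (N , 1 + N) ｝) N (2 + x)) N (5 + ℓ)
    detour {x} 1≤x y<n n<N new-x new-y O-N T = weaken sub
        (ascend (n<1+n N) n≤1+N
          (¬∪ (¬∪ (¬∪ (¬∪ new (≢ˡ (<⇒≢ y<N))) (≢ˡ (<⇒≢ y<N))) (≢ˡ (<⇒≢ x<N))) (≢ˡ (<⇒≢ x<N)))
        (descend (m<n⇒m<1+n x<N) n≤1+N
          (¬∪ (¬∪ (¬∪ (not-done 1≤x ≤-refl x<N (n≤1+n N)) (≢ˡ 1+n≢n)) (≢ˡ 1+n≢n)) (≢ʳ (<⇒≢ (m<n⇒m<1+n n<N))))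
        (ascend x<n ≤-refl (¬∪ (¬∪ (low new-x) (≢ˡ 1+n≢n)) (≢ˡ 1+n≢n))
        (descend y<n ≤-refl (¬∪ (low new-y) (≢ʳ (<⇒≢ n<N ∘ sym)))
        (ascend y<N n≤N (not-done 1≤x (n≤1+n x) y<N ≤-refl) T)))))
      where
      y<N : 1 + x < N
      y<N = <-trans y<n n<N
      x<n : x < n
      x<n = <-trans (n<1+n x) y<n
      x<N : x < N
      x<N = <-trans x<n n<N
      low : ∀ {p} → ¬ O (p , n) → ¬ Done O N x (p , n)
      low new (inj₁ (inj₁ o)) = new o
      low new (inj₁ (inj₂ ((N≤n , _) , _))) = <⇒≱ n<N N≤n
      low new (inj₂ refl) = <-irrefl refl n<N
      new : ¬ Done O N x (N , 1 + N)
      new (inj₁ (inj₁ o)) = O-N (n≤1+n N) o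
      new (inj₁ (inj₂ (_ , _ , N<x))) = <-asym N<x x<N
      O′ = ((O ∪ ｛ (x , n) ｝) ∪ ｛ (1 + x , n) ｝) ∪ ｛ (N , 1 + N) ｝
      now : ∀ {p q} → Layer N (p , q) → x ≤ p → p < 2 + x → Done O′ N (2 + x) (p , q)
      now l i≤p p<2+i = inj₁ (inj₂ (l , ≤-trans 1≤x i≤p , p<2+i))
      -- The target also contains `(x , N)` and `(1 + x , 1 + N)`, the two edges that the detour
      -- gives up; a superset of the used edges suffices.
      sub : (((((Done O N x ∪ ｛ (1 + x , N) ｝) ∪ ｛ (1 + x , n) ｝) ∪ ｛ (x , n) ｝)
               ∪ ｛ (x , 1 + N) ｝) ∪ ｛ (N , 1 + N) ｝) ⊆ Done O′ N (2 + x)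
      sub (inj₂ refl) = inj₁ (inj₁ (inj₂ refl))
      sub (inj₁ (inj₂ refl)) = now 1+N∈ ≤-refl (m≤n+m (1 + x) 1)
      sub (inj₁ (inj₁ (inj₂ refl))) = inj₁ (inj₁ (inj₁ (inj₁ (inj₂ refl))))
      sub (inj₁ (inj₁ (inj₁ (inj₂ refl)))) = inj₁ (inj₁ (inj₁ (inj₂ refl)))
      sub (inj₁ (inj₁ (inj₁ (inj₁ (inj₂ refl))))) = now N∈ (n≤1+n x) ≤-refl
      sub (inj₁ (inj₁ (inj₁ (inj₁ (inj₁ (inj₁ (inj₁ o))))))) = inj₁ (inj₁ (inj₁ (inj₁ (inj₁ o))))
      sub (inj₁ (inj₁ (inj₁ (inj₁ (inj₁ (inj₁ (inj₂ (l , 1≤p , p<x)))))))) =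
        inj₁ (inj₂ (l , 1≤p , <-≤-trans p<x (m≤n+m x 2)))
      sub (inj₁ (inj₁ (inj₁ (inj₁ (inj₁ (inj₂ eq)))))) = inj₂ eq

module _ {n N ℓ : ℕ} {O : Pred Edge 0ℓ} (n≤N : n ≤ N) (O<N : O ⊆ Below N) (T : Trail n O 0 ℓ) where
  open Block n≤N

  private
    O-low : ∀ {y q} → N ≤ q → ¬ O (y , q)
    O-low N≤q o = <⇒≱ (O<N o) N≤q

  -- The whole layer is used: 1 edge to enter, 4 for each of the `k` pairs and 2 to leave.
  odd-block : ∀ k → N ≡ 1 + 2 * k → Trail n (O ∪ Layer N) 0 (ℓ + (2 * N + 1))
  odd-block k refl = subst (Trail n _ 0) (eq k ℓ)
      (leave-via-edge (λ _ → O-low) (s≤s z≤n) O-low (≤-reflexive (+-comm (2 * k) 1))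
        (cycles (λ _ → O-low) k ≤-refl (≤-reflexive (+-comm (2 * k) 1))
          (enter (λ _ → O-low) (s≤s z≤n) T)))
    where
    eq : ∀ k ℓ → 2 + (4 * k + (1 + ℓ)) ≡ ℓ + (2 * (1 + 2 * k) + 1)
    eq = solve-∀

  -- 1 edge to enter, `4 * k` in cycles and 3 to leave; just the edge between `N` and `1 + N` is
  -- left over.
  even-block : ∀ k → N ≡ 2 + 2 * k → Trail n (O ∪ Layer N) 0 (ℓ + 2 * N)
  even-block k refl = subst (Trail n _ 0) (eq k ℓ)
      (leave-via-vertex (λ _ → O-low) (cong suc (+-comm 1 (2 * k))) (m≤n+m 1 (2 * k))
        (cycles (λ _ → O-low) k ≤-refl (≤-trans (≤-reflexive (+-comm (2 * k) 1)) (n≤1+n _))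
          (enter (λ _ → O-low) (s≤s z≤n) T)))
    where
    eq : ∀ k ℓ → 3 + (4 * k + (1 + ℓ)) ≡ ℓ + 2 * (2 + 2 * k)
    eq = solve-∀

  -- The detour replaces the 4-cycle of the pair `x`, `1 + x`, with `j` cycles before it and `m`
  -- after. It gains the one edge that `even-block` falls short of.
  detour-block : ∀ j m → N ≡ 2 + 2 * (j + suc m) → n < N → let x = 2 * j + 1 in
                 1 + x < n → ¬ O (x , n) → ¬ O (1 + x , n) →
                 Trail n ((((O ∪ ｛ (x , n) ｝) ∪ ｛ (1 + x , n) ｝) ∪ ｛ (N , 1 + N) ｝) ∪ Layer N)
                       0 (ℓ + (2 * N + 1))
  detour-block j m refl n<N y<n new-x new-y = subst (Trail n _ 0) (eq j m ℓ)
      (leave-via-vertex low′ (eq₁ j m) (≤-trans (s≤s z≤n) (m≤n+m (2 + (2 * j + 1)) (2 * m)))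
        (cycles low′ m (s≤s z≤n) (≤-trans (≤-reflexive (eq₂ j m)) (n≤1+n _))
          (detour (λ _ → O-low) (m≤n+m 1 _) y<n n<N new-x new-y O-low
            (cycles (λ _ → O-low) j ≤-refl
              (≤-trans (m≤n+m (2 * j + 1) 2) (≤-trans y<n n≤N))
              (enter (λ _ → O-low) (s≤s z≤n) T)))))
    where
    O′ = ((O ∪ ｛ (2 * j + 1 , n) ｝) ∪ ｛ (1 + (2 * j + 1) , n) ｝) ∪ ｛ (N , 1 + N) ｝
    low′ : ∀ {y q} → y < N → N ≤ q → ¬ O′ (y , q)
    low′ y<N N≤q (inj₁ (inj₁ (inj₁ o))) = O-low N≤q o
    low′ y<N N≤q (inj₁ (inj₁ (inj₂ refl))) = <⇒≱ n<N N≤q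
    low′ y<N N≤q (inj₁ (inj₂ refl)) = <⇒≱ n<N N≤q
    low′ y<N N≤q (inj₂ refl) = <-irrefl refl y<N
    eq : ∀ j m ℓ → 3 + (4 * m + (5 + (4 * j + (1 + ℓ)))) ≡ ℓ + (2 * (2 + 2 * (j + suc m)) + 1)
    eq = solve-∀
    eq₁ : ∀ j m → 2 + 2 * (j + suc m) ≡ 1 + (2 * m + (2 + (2 * j + 1)))
    eq₁ = solve-∀
    eq₂ : ∀ j m → 2 * m + (2 + (2 * j + 1)) ≡ 1 + 2 * (j + suc m)
    eq₂ = solve-∀

-- Long trails for each parity of `n` and `t`

triangle : ℕ → ℕ
triangle zero    = 0
triangle (suc t) = t + triangle t

-- The number of edges of H for `s = t`.
full : ℕ → ℕ → ℕ
full n t = n * t + triangle t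

full-2+ : ∀ n t → full n (2 + t) ≡ full n t + (2 * (n + t) + 1)
full-2+ n t = eq n t (triangle t)
  where
  eq : ∀ n t d → n * (2 + t) + (1 + t + (t + d)) ≡ n * t + d + (2 * (n + t) + 1)
  eq = solve-∀

LongTrail : ℕ → ℕ → ℕ → Set
LongTrail n t loss = ∃[ ℓ ] (Trail n (Below (n + t)) 0 ℓ × ℓ + loss ≡ full n t)

+-2+ : ∀ n t → 2 + (n + t) ≡ n + (2 + t)
+-2+ = solve-∀

below∪layer : ∀ n t → (Below (n + t) ∪ Layer (n + t)) ⊆ Below (n + (2 + t))
below∪layer n t (inj₁ b)       = <-≤-trans b (+-monoʳ-≤ n (m≤n+m t 2))
below∪layer n t (inj₂ (_ , l)) = ≤-trans l (≤-reflexive (+-2+ n t))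

extend-odd : ∀ {n t c} k → n + t ≡ 1 + 2 * k → LongTrail n t c → LongTrail n (2 + t) c
extend-odd {n} {t} {c} k N≡ (ℓ , T , eq) =
  ℓ + (2 * (n + t) + 1) , weaken (λ {e} → below∪layer n t {e}) (odd-block {O = Below (n + t)} (m≤m+n n t) (λ {e} b → b) T k N≡) ,
  trans (shift ℓ _ c) (trans (cong (_+ (2 * (n + t) + 1)) eq) (sym (full-2+ n t)))
  where
  shift : ∀ ℓ m c → ℓ + m + c ≡ ℓ + c + m
  shift = solve-∀

extend-even : ∀ {n t c} k → n + t ≡ 2 + 2 * k → LongTrail n t c → LongTrail n (2 + t) (1 + c)
extend-even {n} {t} {c} k N≡ (ℓ , T , eq) =
  ℓ + 2 * (n + t) , weaken (λ {e} → below∪layer n t {e}) (even-block {O = Below (n + t)} (m≤m+n n t) (λ {e} b → b) T k N≡) ,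
  trans (shift ℓ _ c) (trans (cong (_+ (2 * (n + t) + 1)) eq) (sym (full-2+ n t)))
  where
  shift : ∀ ℓ m c → ℓ + m + (1 + c) ≡ ℓ + c + (m + 1)
  shift = solve-∀

two : ∀ q → 2 + 2 * q ≡ 2 * suc q
two = solve-∀

base-even : ∀ n → LongTrail n 0 0
base-even n = 0 , mkTrail [] [] [] refl , eq n
  where
  eq : ∀ n → 0 ≡ n * 0 + 0
  eq = solve-∀

long-even-odd : ∀ r q → LongTrail (1 + 2 * r) (2 * q) 0
long-even-odd r zero    = base-even _
long-even-odd r (suc q) = subst (λ t → LongTrail (1 + 2 * r) t (0)) (two q)
  (extend-odd (r + q) (eq r q) (long-even-odd r q))
  where
  eq : ∀ r q → 1 + 2 * r + 2 * q ≡ 1 + 2 * (r + q)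
  eq = solve-∀

long-even-even : ∀ r q → LongTrail (2 + 2 * r) (2 * q) q
long-even-even r zero    = base-even _
long-even-even r (suc q) = subst (λ t → LongTrail (2 + 2 * r) t (suc q)) (two q)
  (extend-even (r + q) (eq r q) (long-even-even r q))
  where
  eq : ∀ r q → 2 + 2 * r + 2 * q ≡ 2 + 2 * (r + q)
  eq = solve-∀

-- For odd t and odd n, these edges are reserved for the detours to come.
Spare : ℕ → ℕ → Pred Edge 0ℓ
Spare n t (p , q) = q ≡ n × t ≤ p × 2 + p ≤ n

Unspared : ℕ → ℕ → Pred Edge 0ℓ
Unspared n t e = Below (n + t) e × ¬ Spare n t e

-- For `t = 1` the graph H is a star, so two edges are the most a trail can have. It ends at
-- `n - 1`, which leaves the edges from 1 up to `n - 2` spare.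
base-odd : ∀ c → Trail (2 + c) (Unspared (2 + c) 1) 0 2
base-odd c = mkTrail
  (up (s≤s z≤n) ≤-refl (down ≤-refl ≤-refl []))
  (((λ ()) ∷ []) ∷ [] ∷ [])
  ((≤-reflexive (+-comm 1 (2 + c)) , λ { (_ , () , _) }) ∷
   (≤-reflexive (+-comm 1 (2 + c)) , λ { (_ , _ , le) → <-irrefl refl le }) ∷ [])
  refl

long-odd-base : ∀ c → 2 + c ≡ full (2 + c) 1
long-odd-base c = eq c
  where
  eq : ∀ c → 2 + c ≡ (2 + c) * 1 + 0
  eq = solve-∀

-- All loss comes from the star at the start, namely `n - 2` edges; every later block has odd
-- `n + t` and uses its whole layer.
long-odd-even : ∀ r q → LongTrail (2 + 2 * r) (1 + 2 * q) (2 * r)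
long-odd-even r zero    = 2 , weaken proj₁ (base-odd (2 * r)) , long-odd-base (2 * r)
long-odd-even r (suc q) = subst (λ t → LongTrail (2 + 2 * r) t (2 * r)) (cong suc (two q))
  (extend-odd (1 + r + q) (eq r q) (long-odd-even r q))
  where
  eq : ∀ r q → 2 + 2 * r + (1 + 2 * q) ≡ 1 + 2 * (1 + r + q)
  eq = solve-∀

-- Each block spends the spare edges at `t` and `1 + t` on a detour, so the loss stays at `n - 2`.
-- The condition `q ≤ r` says `t ≤ n - 2`, which is as long as spare edges last.
long-odd-odd-detours : ∀ r q → q ≤ r →
  ∃[ ℓ ] (Trail (3 + 2 * r) (Unspared (3 + 2 * r) (1 + 2 * q)) 0 ℓ ×
          ℓ + (1 + 2 * r) ≡ full (3 + 2 * r) (1 + 2 * q))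
long-odd-odd-detours r zero    _   = 2 , base-odd (1 + 2 * r) , long-odd-base (1 + 2 * r)
long-odd-odd-detours r (suc q) q<r with long-odd-odd-detours r q (<⇒≤ q<r)
... | ℓ , T , eq = ℓ + (2 * N + 1) ,
      subst (λ t → Trail n (Unspared n t) 0 (ℓ + (2 * N + 1))) (cong suc (two q))
        -- With `q` cycles first, the detour takes place at `x = t`, the first spare edge.
        (weaken sub (detour-block (m≤m+n n t) proj₁ T q r (N≡ r q) n<N y<n
          (λ (_ , new) → new (refl , ≤-reflexive (+-comm 1 (2 * q)) , ≤-trans (n≤1+n _) 2+y≤n))
          (λ (_ , new) → new (refl , ≤-trans (n≤1+n t) (≤-reflexive (cong suc (+-comm 1 (2 * q)))) , 2+y≤n)))) ,
      trans (shift ℓ _ (1 + 2 * r))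
        (trans (cong (_+ (2 * N + 1)) eq) (trans (sym (full-2+ n t)) (cong (full n ∘ suc) (two q))))
  where
  n = 3 + 2 * r
  t = 1 + 2 * q
  N = n + t
  x = 2 * q + 1
  shift : ∀ ℓ m c → ℓ + m + c ≡ ℓ + c + m
  shift = solve-∀
  N≡ : ∀ r q → 3 + 2 * r + (1 + 2 * q) ≡ 2 + 2 * (q + suc r)
  N≡ = solve-∀
  n<N : n < N
  n<N = m<m+n n (s≤s z≤n)
  2+y≡ : ∀ q → 3 + (2 * q + 1) ≡ 2 + 2 * suc q
  2+y≡ = solve-∀
  2+y≤n : 3 + x ≤ n
  2+y≤n = ≤-trans (≤-reflexive (2+y≡ q)) (≤-trans (s≤s (s≤s (*-monoʳ-≤ 2 q<r))) (n≤1+n _))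
  y<n : 1 + x < n
  y<n = <-trans (n<1+n _) 2+y≤n
  n<n+ : n < n + (2 + t)
  n<n+ = m<m+n n (s≤s z≤n)
  sub : ((((Unspared n t ∪ ｛ (x , n) ｝) ∪ ｛ (1 + x , n) ｝) ∪ ｛ (N , 1 + N) ｝) ∪ Layer N)
        ⊆ Unspared n (2 + t)
  sub (inj₁ (inj₁ (inj₁ (inj₁ (b , new))))) =
    <-≤-trans b (+-monoʳ-≤ n (m≤n+m t 2)) ,
    λ (q≡n , 2+t≤p , 2+p≤n) → new (q≡n , ≤-trans (m≤n+m t 2) 2+t≤p , 2+p≤n)
  sub (inj₁ (inj₁ (inj₁ (inj₂ refl)))) =
    n<n+ , λ (_ , 2+t≤x , _) → <⇒≱ (s≤s (≤-trans (≤-reflexive (+-comm (2 * q) 1)) (n≤1+n _))) 2+t≤x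
  sub (inj₁ (inj₁ (inj₂ refl))) =
    n<n+ , λ (_ , 2+t≤y , _) → <⇒≱ (s≤s (s≤s (≤-reflexive (+-comm (2 * q) 1)))) 2+t≤y
  sub (inj₁ (inj₂ refl)) =
    ≤-reflexive (+-2+ n t) , λ (N+1≡n , _) → <⇒≢ (m<n⇒m<1+n n<N) (sym N+1≡n)
  sub (inj₂ (N≤q , q<2+N)) =
    ≤-trans q<2+N (≤-reflexive (+-2+ n t)) , λ (q≡n , _) → <⇒≱ n<N (≤-trans N≤q (≤-reflexive q≡n))

long-odd-odd-few : ∀ r q → q ≤ r → LongTrail (3 + 2 * r) (1 + 2 * q) (1 + 2 * r)
long-odd-odd-few r q q≤r with long-odd-odd-detours r q q≤r
... | ℓ , T , eq = ℓ , weaken proj₁ T , eq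

-- From `q = r` on no pair of spare edges is left, and each further block loses one edge.
long-odd-odd-many : ∀ r e → LongTrail (3 + 2 * r) (1 + 2 * (e + r)) (e + (1 + 2 * r))
long-odd-odd-many r zero    = long-odd-odd-few r r ≤-refl
long-odd-odd-many r (suc e) = subst (λ t → LongTrail (3 + 2 * r) t (suc e + (1 + 2 * r))) (cong suc (two (e + r)))
  (extend-even (1 + r + (e + r)) (eq r (e + r)) (long-odd-odd-many r e))
  where
  eq : ∀ r q → 3 + 2 * r + (1 + 2 * q) ≡ 2 + 2 * (1 + r + q)
  eq = solve-∀

-- Trails as harmonious colourings of the lollipop graph

lookup-injective : ∀ {A : Set} {xs : List A} → Unique xs → ∀ i j → lookup xs i ≡ lookup xs j → i ≡ j
lookup-injective (x∉ ∷ u) zero    zero    eq = refl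
lookup-injective (x∉ ∷ u) zero    (suc j) eq = contradiction eq (All.lookup x∉ (∈-lookup j))
lookup-injective (x∉ ∷ u) (suc i) zero    eq = contradiction (sym eq) (All.lookup x∉ (∈-lookup i))
lookup-injective (x∉ ∷ u) (suc i) (suc j) eq = cong suc (lookup-injective u i j eq)

walk-take : ∀ {n v es} j → Walk n v es → Walk n v (take j es)
walk-take zero    w               = []
walk-take (suc j) []              = []
walk-take (suc j) (up p<q n≤q w)   = up p<q n≤q (walk-take j w)
walk-take (suc j) (down p<q n≤q w) = down p<q n≤q (walk-take j w)

trail-take : ∀ {n P v ℓ j} → j ≤ ℓ → Trail n P v ℓ → Trail n P v j
trail-take {j = j} j≤ℓ (mkTrail {es} w u a refl) =
  mkTrail (walk-take j w) (take⁺ j u) (All.take⁺ j a) (trans (length-take j es) (m≤n⇒m⊓n≡m j≤ℓ))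

vertex : ∀ {n v es} → Walk n v es → Fin (suc (length es)) → ℕ
vertex {v = v} w        zero    = v
vertex (up   _ _ w) (suc i) = vertex w i
vertex (down _ _ w) (suc i) = vertex w i

Joins : Edge → ℕ → ℕ → Set
Joins (p , q) a b = (a ≡ p × b ≡ q) ⊎ (a ≡ q × b ≡ p)

joins-sym : ∀ {e a b} → Joins e a b → Joins e b a
joins-sym (inj₁ (x , y)) = inj₂ (y , x)
joins-sym (inj₂ (x , y)) = inj₁ (y , x)

vertex-joins : ∀ {n v es} (w : Walk n v es) i →
               Joins (lookup es i) (vertex w (inject₁ i)) (vertex w (suc i))
vertex-joins (up _ _ _)   zero    = inj₁ (refl , refl)
vertex-joins (down _ _ _) zero    = inj₂ (refl , refl)
vertex-joins (up _ _ w)   (suc i) = vertex-joins w i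
vertex-joins (down _ _ w) (suc i) = vertex-joins w i

Proper-edge : ℕ → Edge → Set
Proper-edge n (p , q) = p < q × n ≤ q

edge-proper : ∀ {n v es} (w : Walk n v es) i → Proper-edge n (lookup es i)
edge-proper (up p<q n≤q _)   zero    = p<q , n≤q
edge-proper (down p<q n≤q _) zero    = p<q , n≤q
edge-proper (up _ _ w)   (suc i) = edge-proper w i
edge-proper (down _ _ w) (suc i) = edge-proper w i

vertex-below : ∀ {n v es k} (w : Walk n v es) → v < k → All (Below k) es → ∀ i → vertex w i < k
vertex-below w v<k b zero = v<k
vertex-below (up p<q _ w)   v<k (q<k ∷ b) (suc i) = vertex-below w q<k b i
vertex-below (down p<q _ w) v<k (q<k ∷ b) (suc i) = vertex-below w (<-trans p<q q<k) b i

joins-unique : ∀ {n e e′ a b} → Proper-edge n e → Proper-edge n e′ → Joins e a b → Joins e′ a b → e ≡ e′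
joins-unique _ _ (inj₁ (refl , refl)) (inj₁ (refl , refl)) = refl
joins-unique (l , _) (l′ , _) (inj₁ (refl , refl)) (inj₂ (refl , refl)) = contradiction l (<-asym l′)
joins-unique (l , _) (l′ , _) (inj₂ (refl , refl)) (inj₁ (refl , refl)) = contradiction l (<-asym l′)
joins-unique _ _ (inj₂ (refl , refl)) (inj₂ (refl , refl)) = refl

joins-≢ : ∀ {n e a b} → Proper-edge n e → Joins e a b → a ≢ b
joins-≢ (l , _) (inj₁ (refl , refl)) = <⇒≢ l
joins-≢ (l , _) (inj₂ (refl , refl)) = >⇒≢ l

joins-≥ : ∀ {n e a b} → Proper-edge n e → Joins e a b → a < n → ¬ b < n
joins-≥ (_ , n≤q) (inj₁ (refl , refl)) a<n b<n = <⇒≱ b<n n≤q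
joins-≥ (_ , n≤q) (inj₂ (refl , refl)) a<n b<n = <⇒≱ a<n n≤q

Ends : ∀ {m} → Fin m → Fin (suc m) → Fin (suc m) → Set
Ends i a b = (a ≡ inject₁ i × b ≡ suc i) ⊎ (a ≡ suc i × b ≡ inject₁ i)

path-step : ∀ {m} {a b : Fin (suc m)} → toℕ b ≡ suc (toℕ a) → ∃[ i ] (a ≡ inject₁ i × b ≡ suc i)
path-step {b = suc i} e =
  i , toℕ-injective (trans (sym (cong pred e)) (sym (toℕ-inject₁ i))) , refl

path-ends : ∀ {m} {a b : Fin (suc m)} → Adj (path (suc m)) a b → ∃[ i ] Ends i a b
path-ends (inj₁ e) = let i , p , q = path-step e in i , inj₁ (p , q)
path-ends (inj₂ e) = let i , p , q = path-step e in i , inj₂ (q , p)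

-- The clique takes the colours below `n` and the path follows the trail, cut to the right length.
-- Clique and path never share a colour pair because every trail edge has an end at `n` or above.
trail⇒colorable : ∀ {n k m ℓ} (u : Fin n) → n ≤ k → m ≤ ℓ →
                  Trail n (Below k) 0 ℓ → HarmoniouslyColorable (lollipop n (suc m) u) k
trail⇒colorable {suc n} {k} u n≤k m≤ℓ T with trail-take m≤ℓ T
... | mkTrail {es} w uniq below refl = c , proper , unique
  where
  G = lollipop (suc n) (suc (length es)) u
  -- The trail starts at colour 0, so `u` and 0 are exchanged to give `u` that colour.
  π = Perm.transpose u zero

  low : ∀ i → vertex w i < k
  low = vertex-below w (≤-trans (s≤s z≤n) n≤k) below

  c : Coloring G k
  c (inj₁ i) = inject≤ (π ⟨$⟩ʳ i) n≤k
  c (inj₂ j) = fromℕ< (low (suc j))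

  V : Vertex G → ℕ
  V x = toℕ (c x)

  V-path : ∀ a → V (glue u a) ≡ vertex w a
  V-path (suc j) = toℕ-fromℕ< (low (suc j))
  V-path zero = trans (toℕ-inject≤ _ n≤k) (cong toℕ π-u)
    where
    π-u : π ⟨$⟩ʳ u ≡ zero
    π-u with u ≟F u
    ... | yes _   = refl
    ... | no  u≢u = contradiction refl u≢u

  V-clique : ∀ i → V (inj₁ i) < suc n
  V-clique i = ≤-trans (≤-reflexive (cong suc (toℕ-inject≤ _ n≤k))) (toℕ<n (π ⟨$⟩ʳ i))

  V-clique-injective : ∀ {i j} → V (inj₁ i) ≡ V (inj₁ j) → i ≡ j
  V-clique-injective {i} {j} eq = trans (sym (Perm.inverseˡ π)) (trans (cong (π ⟨$⟩ˡ_)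
    (toℕ-injective (trans (sym (toℕ-inject≤ _ n≤k)) (trans eq (toℕ-inject≤ _ n≤k))))) (Perm.inverseˡ π))

  V-joins : ∀ {a b} i → Ends i a b → Joins (lookup es i) (V (glue u a)) (V (glue u b))
  V-joins {a} {b} i ends rewrite V-path a | V-path b with ends
  ... | inj₁ (refl , refl) = vertex-joins w i
  ... | inj₂ (refl , refl) = joins-sym (vertex-joins w i)

  proper : Proper G c
  proper (inj₁ (a , b , a≢b , refl , refl)) eq = a≢b (V-clique-injective (cong toℕ eq))
  proper (inj₂ (a , b , adj , refl , refl)) eq with path-ends adj
  ... | i , ends = joins-≢ (edge-proper w i) (V-joins i ends) (cong toℕ eq)

  -- Equal colour pairs give equal trail edges, hence equal indices; the direction agrees as well,
  -- since the two ends have different colours.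
  same : ∀ {a b a′ b′ i j} → Ends i a b → Ends j a′ b′ →
         V (glue u a) ≡ V (glue u a′) → V (glue u b) ≡ V (glue u b′) → a ≡ a′ × b ≡ b′
  same {a} {b} {i = i} {j} ends ends′ eqa eqb
    with lookup-injective uniq i j
           (joins-unique (edge-proper w i) (edge-proper w j) (V-joins i ends)
             (subst₂ (Joins (lookup es j)) (sym eqa) (sym eqb) (V-joins j ends′)))
  same (inj₁ (refl , refl)) (inj₁ (refl , refl)) _ _ | refl = refl , refl
  same (inj₂ (refl , refl)) (inj₂ (refl , refl)) _ _ | refl = refl , refl
  same {i = i} (inj₁ (refl , refl)) (inj₂ (refl , refl)) eqa _ | refl =
    contradiction eqa (joins-≢ (edge-proper w i) (V-joins i (inj₁ (refl , refl))))
  same {i = i} (inj₂ (refl , refl)) (inj₁ (refl , refl)) eqa _ | refl =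
    contradiction eqa (joins-≢ (edge-proper w i) (V-joins i (inj₂ (refl , refl))))

  mixed : ∀ {i a b a′ b′} → Ends i a b → V (glue u a) ≡ V (inj₁ a′) → V (glue u b) ≢ V (inj₁ b′)
  mixed {i} {a′ = a′} {b′} ends eqa eqb = joins-≥ (edge-proper w i) (V-joins i ends)
    (≤-trans (≤-reflexive (cong suc eqa)) (V-clique a′))
    (≤-trans (≤-reflexive (cong suc eqb)) (V-clique b′))

  unique : PairwiseUnique G c
  unique i≢j (inj₁ (a , b , _ , refl , refl)) refl refl (inj₁ (a′ , b′ , _ , refl , refl)) eqa eqb =
    cong inj₁ (V-clique-injective (sym (cong toℕ eqa))) , cong inj₁ (V-clique-injective (sym (cong toℕ eqb)))
  unique i≢j (inj₁ (a , b , _ , refl , refl)) refl refl (inj₂ (a′ , b′ , adj , refl , refl)) eqa eqb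
    with path-ends adj
  ... | i , ends = contradiction (cong toℕ eqb) (mixed {a′ = a} {b} ends (cong toℕ eqa))
  unique i≢j (inj₂ (a , b , adj , refl , refl)) refl refl (inj₁ (a′ , b′ , _ , refl , refl)) eqa eqb
    with path-ends adj
  ... | i , ends = contradiction (sym (cong toℕ eqb)) (mixed {a′ = a′} {b′} ends (sym (cong toℕ eqa)))
  unique i≢j (inj₂ (a , b , adj , refl , refl)) refl refl (inj₂ (a′ , b′ , adj′ , refl , refl)) eqa eqb
    with path-ends adj | path-ends adj′
  ... | i , ends | j , ends′ =
    let a≡ , b≡ = same ends ends′ (sym (cong toℕ eqa)) (sym (cong toℕ eqb))
    in cong (glue u) a≡ , cong (glue u) b≡

-- Harmonious colourings as trails

module Harmonious {n k ℓ} (u : Fin n) (c : Coloring (lollipop n (suc ℓ) u) k)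
  (harmonious : IsHarmonious (lollipop n (suc ℓ) u) c) where

  private
    G = lollipop n (suc ℓ) u
    proper = proj₁ harmonious
    unique : PairwiseUnique G c
    unique = proj₂ harmonious

    at : Fin (suc ℓ) → Vertex G
    at = glue u

    clique-adj : ∀ {i j} → i ≢ j → Adj G (inj₁ i) (inj₁ j)
    clique-adj {i} {j} i≢j = inj₁ (i , j , i≢j , refl , refl)

    path-adj : ∀ i → Adj G (at (inject₁ i)) (at (suc i))
    path-adj i = inj₂ (inject₁ i , suc i , inj₁ (cong suc (sym (toℕ-inject₁ i))) , refl , refl)

  c₀ : Fin n → Fin k
  c₀ i = c (inj₁ i)

  p : Fin (suc ℓ) → Fin k
  p i = c (at i)

  c₀-injective : ∀ {i j} → c₀ i ≡ c₀ j → i ≡ j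
  c₀-injective {i} {j} eq with i ≟F j
  ... | yes i≡j = i≡j
  ... | no  i≢j = contradiction eq (proper (clique-adj i≢j))

  n≤k : n ≤ k
  n≤k = injective⇒≤ c₀-injective

  steps : ∀ i → p (inject₁ i) ≢ p (suc i)
  steps i = proper (path-adj i)

  trail : ∀ i j →
    (p (inject₁ i) ≡ p (inject₁ j) × p (suc i) ≡ p (suc j)) ⊎
    (p (inject₁ i) ≡ p (suc j) × p (suc i) ≡ p (inject₁ j)) → i ≡ j
  trail i j (inj₁ (eq , eq′)) =
    suc-injective (glue-injective u
      (proj₂ (unique (steps i) (path-adj i) refl refl (path-adj j) (sym eq) (sym eq′))))
  trail i j (inj₂ (eq , eq′)) =
    let e , e′ = unique (steps i) (path-adj i) refl refl (adj-sym G (path-adj j)) (sym eq) (sym eq′)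
        i≡1+j = trans (sym (toℕ-inject₁ i)) (cong toℕ (glue-injective u e))
        1+i≡j = trans (cong toℕ (glue-injective u e′)) (toℕ-inject₁ j)
    -- Meeting the same edge backwards would force both `i ≡ 1 + j` and `j ≡ 1 + i`.
    in contradiction (≤-reflexive 1+i≡j) (<-asym (≤-reflexive (sym i≡1+j)))

  -- The pair of clique colours already belongs to a clique edge, which would have to be this path
  -- edge; but the path vertex `suc i` lies outside the clique.
  avoids : ∀ i a b → c₀ a ≡ p (inject₁ i) → c₀ b ≢ p (suc i)
  avoids i a b eqa eqb
    with () ← proj₂ (unique (steps i) (path-adj i) refl refl
                (clique-adj (λ { refl → steps i (trans (sym eqa) eqb) })) eqa eqb)

triangle-square : ∀ t → t * t ≡ 2 * triangle t + t
triangle-square zero    = refl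
triangle-square (suc t) = begin
  suc (t + t * suc t)                    ≡⟨ cong (λ s → suc (t + s)) (*-suc t t) ⟩
  suc (t + (t + t * t))                  ≡⟨ cong (λ s → suc (t + (t + s))) (triangle-square t) ⟩
  suc (t + (t + (2 * triangle t + t)))   ≡⟨ eq t (triangle t) ⟩
  2 * (t + triangle t) + suc t           ∎
  where
  open ≡-Reasoning
  eq : ∀ t d → suc (t + (t + (2 * d + t))) ≡ 2 * (t + d) + suc t
  eq = solve-∀

triangle-half : ∀ t → t * (t ∸ 1) / 2 ≡ triangle t
triangle-half t = trans (cong (_/ 2) (double t)) (m*n/n≡m (triangle t) 2)
  where
  double : ∀ t → t * (t ∸ 1) ≡ triangle t * 2
  double zero    = refl
  double (suc t) = trans (cong (t +_) (triangle-square t)) (eq t (triangle t))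
    where
    eq : ∀ t d → t + (2 * d + t) ≡ (t + d) * 2
    eq = solve-∀

bound≡ : ∀ n t → bound n t ≡ suc (full n t)
bound≡ n t = cong (λ d → 1 + n * t + d) (triangle-half t)

square-full : ∀ n t → 2 * (n * t) + t * t ≡ 2 * full n t + t
square-full n t = trans (cong (2 * (n * t) +_) (triangle-square t)) (eq (n * t) (triangle t) t)
  where
  eq : ∀ a d t → 2 * a + (2 * d + t) ≡ 2 * (a + d) + t
  eq = solve-∀

-- Parity absorbs the 1 that the last vertex adds in `trail-bound-even`.
half-≤ : ∀ {a b} → 2 * a ≤ 2 * b + 1 → a ≤ b
half-≤ {a} {b} le = s≤s⁻¹ (*-cancelˡ-< 2 a (suc b) (≤-trans (s≤s le) (≤-reflexive (eq b))))
  where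
  eq : ∀ b → 1 + (2 * b + 1) ≡ 2 * suc b
  eq = solve-∀

Colorable : (n ℓ : ℕ) → Fin n → ℕ → Set
Colorable n ℓ u = HarmoniouslyColorable (lollipop n (suc ℓ) u)

module _ {n ℓ : ℕ} {u : Fin n} where

  colorable⇒n≤k : ∀ {k} → Colorable n ℓ u k → n ≤ k
  colorable⇒n≤k (c , h) = Harmonious.n≤k u c h

  module _ {s} (col : Colorable n ℓ u (n + s)) where
    private
      open Harmonious u (proj₁ col) (proj₂ col)

      2full : ∀ {c} → 2 * (n * s) + s * s + c ≡ 2 * full n s + s + c
      2full {c} = cong (_+ c) (square-full n s)

    colorable⇒≤full : ℓ ≤ full n s
    colorable⇒≤full = *-cancelˡ-≤ 2 (+-cancelʳ-≤ s _ _
      (≤-trans (trail-bound refl c₀ c₀-injective p (u , refl) steps trail avoids)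
               (≤-reflexive (square-full n s))))

    even-bound : ∀ q r → s ≡ 2 * q → n + s ≡ 2 * r → ℓ + q ≤ full n s
    even-bound q r refl even = half-≤ (+-cancelʳ-≤ s _ _ (begin
      2 * (ℓ + q) + s                 ≡⟨ eq ℓ q ⟩
      2 * ℓ + 2 * s                   ≤⟨
          trail-bound-even refl c₀ c₀-injective p (u , refl) steps trail avoids r even ⟩
      2 * (n * s) + s * s + 1         ≡⟨ 2full ⟩
      2 * full n s + s + 1            ≡⟨ eq′ (full n s) s ⟩
      2 * full n s + 1 + s            ∎))
      where
      open ≤-Reasoning
      eq : ∀ ℓ q → 2 * (ℓ + q) + 2 * q ≡ 2 * ℓ + 2 * (2 * q)
      eq = solve-∀
      eq′ : ∀ f s → 2 * f + s + 1 ≡ 2 * f + 1 + s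
      eq′ = solve-∀

    odd-few-bound : ∀ q c → s ≡ 1 + 2 * q → n ≡ 2 + c → ℓ + c ≤ full n s
    odd-few-bound q c odd n≡ = *-cancelˡ-≤ 2 (+-cancelʳ-≤ (s + 4) _ _ (begin
      2 * (ℓ + c) + (s + 4)           ≡⟨ eq ℓ c s ⟩
      2 * ℓ + s + 2 * (2 + c)         ≡⟨ cong (λ z → 2 * ℓ + s + 2 * z) n≡ ⟨
      2 * ℓ + s + 2 * n               ≤⟨
          trail-bound-odd refl c₀ c₀-injective p (u , refl) steps trail avoids q odd ⟩
      2 * (n * s) + s * s + 4         ≡⟨ 2full ⟩
      2 * full n s + s + 4            ≡⟨ +-assoc (2 * full n s) s 4 ⟩
      2 * full n s + (s + 4)          ∎))
      where
      open ≤-Reasoning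
      eq : ∀ ℓ c s → 2 * (ℓ + c) + (s + 4) ≡ 2 * ℓ + s + 2 * (2 + c)
      eq = solve-∀

    odd-many-bound : ∀ e r → s ≡ 1 + 2 * (e + r) → n ≡ 3 + 2 * r → ℓ + (e + (1 + 2 * r)) ≤ full n s
    odd-many-bound e r odd n≡ = *-cancelˡ-≤ 2 (+-cancelʳ-≤ (s + 2) _ _ (begin
      2 * (ℓ + (e + (1 + 2 * r))) + (s + 2)             ≡⟨ eq ℓ e r s ⟩
      2 * ℓ + (s + (1 + 2 * (e + r))) + (3 + 2 * r)     ≡⟨ cong₂ (λ x y → 2 * ℓ + (s + x) + y) odd n≡ ⟨
      2 * ℓ + (s + s) + n                               ≡⟨ eq′ ℓ s n ⟩
      2 * ℓ + 2 * s + n                                 ≤⟨ 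
          trail-bound-odd-even refl c₀ c₀-injective p (u , refl) steps trail avoids
            (e + r) (2 + e + 2 * r) odd (trans (cong₂ _+_ n≡ odd) (eq″ e r)) ⟩
      2 * (n * s) + s * s + 2                           ≡⟨ 2full ⟩
      2 * full n s + s + 2                              ≡⟨ +-assoc (2 * full n s) s 2 ⟩
      2 * full n s + (s + 2)                            ∎))
      where
      open ≤-Reasoning
      eq : ∀ ℓ e r s → 2 * (ℓ + (e + (1 + 2 * r))) + (s + 2) ≡ 2 * ℓ + (s + (1 + 2 * (e + r))) + (3 + 2 * r)
      eq = solve-∀
      eq′ : ∀ ℓ s n → 2 * ℓ + (s + s) + n ≡ 2 * ℓ + 2 * s + n
      eq′ = solve-∀
      eq″ : ∀ e r → 3 + 2 * r + (1 + 2 * (e + r)) ≡ 2 * (2 + e + 2 * r)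
      eq″ = solve-∀

-- The parity cases of the theorem

data EvenOrOdd : ℕ → Set where
  is-even : ∀ q → EvenOrOdd (2 * q)
  is-odd  : ∀ q → EvenOrOdd (1 + 2 * q)

evenOrOdd : ∀ n → EvenOrOdd n
evenOrOdd zero = is-even 0
evenOrOdd (suc n) with evenOrOdd n
... | is-even q = is-odd q
... | is-odd  q = subst EvenOrOdd (sym (two q)) (is-even (suc q))

2∣even : ∀ q → 2 ∣ 2 * q
2∣even q = divides q (*-comm 2 q)

2∤odd : ∀ q → 2 ∤ 1 + 2 * q
2∤odd q (divides r eq) = odd≢even q r (trans eq (*-comm r 2))

-- `long` and `max` together make `loss` exact. `loss<` serves the value one below `t`: the edges
-- gained on reaching `t` outweigh the loss there.
record Analysis (n t : ℕ) : Set where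
  field
    -- the number of edges that a longest trail leaves unused
    loss     : ℕ
    long     : LongTrail n t loss
    loss<    : loss < n + t
    max      : ∀ {ℓ u} → Colorable n ℓ u (n + t) → ℓ + loss ≤ full n t
    case⇒    : ∀ {ℓ} → ℓ ≤ full n t → ColorableCase n (suc ℓ) t → ℓ + loss ≤ full n t
    case⇐    : ∀ {ℓ} → ℓ + loss ≤ full n t → ColorableCase n (suc ℓ) t

∸⇒+ : ∀ {ℓ c c′} n t → c ≡ c′ → suc ℓ ≤ bound n t ∸ c → ℓ + c′ ≤ full n t
∸⇒+ {ℓ} {c} n t refl le = s≤s⁻¹ (subst (suc ℓ + c ≤_) (bound≡ n t)
  -- The truncated difference is at least `suc ℓ`, hence positive, so `c` is below the bound and no
  -- truncation occurs.
  (m≤o∸n⇒m+n≤o (suc ℓ) (<⇒≤ (m<n∸o⇒o<n le)) le))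
  where
  m<n∸o⇒o<n : ∀ {m n o} → m < n ∸ o → o < n
  m<n∸o⇒o<n {m} {n} {o} lt = m∸n≢0⇒n<m λ z → contradiction (≤-trans lt (≤-reflexive z)) λ ()

+⇒∸ : ∀ {ℓ c c′} n t → c ≡ c′ → ℓ + c′ ≤ full n t → suc ℓ ≤ bound n t ∸ c
+⇒∸ {ℓ} n t refl le = m+n≤o⇒m≤o∸n (suc ℓ) (≤-trans (s≤s le) (≤-reflexive (sym (bound≡ n t))))

even-even : ∀ r q → Analysis (2 + 2 * r) (2 * q)
even-even r q = record
  { loss  = q
  ; long  = long-even-even r q
  ; loss< = s≤s (≤-trans (m≤m+n q (q + 0)) (m≤n+m (2 * q) (1 + 2 * r)))
  ; max   = λ col → even-bound col q (1 + r + q) refl (eq r q)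
  ; case⇒ = λ where
      _ (inj₁ (_ , odd-n))                     → contradiction 2∣n odd-n
      _ (inj₂ (inj₁ (_ , _ , le)))             → ∸⇒+ n t half le
      _ (inj₂ (inj₂ (inj₁ (odd-t , _ , _))))   → contradiction (2∣even q) odd-t
      _ (inj₂ (inj₂ (inj₂ (odd-t , _ , _))))   → contradiction (2∣even q) odd-t
  ; case⇐ = λ le → inj₂ (inj₁ (2∣even q , 2∣n , +⇒∸ n t half le))
  }
  where
  n = 2 + 2 * r
  t = 2 * q
  eq : ∀ r q → 2 + 2 * r + 2 * q ≡ 2 * (1 + r + q)
  eq = solve-∀
  2∣n : 2 ∣ n
  2∣n = subst (2 ∣_) (sym (two r)) (2∣even (suc r))
  half : t / 2 ≡ q
  half = trans (cong (_/ 2) (*-comm 2 q)) (m*n/n≡m q 2)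

even-odd : ∀ r q → Analysis (1 + 2 * r) (2 * q)
even-odd r q = record
  { loss  = 0
  ; long  = long-even-odd r q
  ; loss< = s≤s z≤n
  ; max   = λ {ℓ} col → ≤-trans (≤-reflexive (+-identityʳ ℓ)) (colorable⇒≤full col)
  ; case⇒ = λ {ℓ} le _ → ≤-trans (≤-reflexive (+-identityʳ ℓ)) le
  ; case⇐ = λ _ → inj₁ (2∣even q , 2∤odd r)
  }

odd-even : ∀ r q → Analysis (2 + 2 * r) (1 + 2 * q)
odd-even r q = record
  { loss  = 2 * r
  ; long  = long-odd-even r q
  ; loss< = s≤s (≤-trans (n≤1+n (2 * r)) (m≤m+n (1 + 2 * r) t))
  ; max   = λ col → odd-few-bound col q (2 * r) refl refl
  ; case⇒ = λ where
      _ (inj₁ (even-t , _))                    → contradiction even-t (2∤odd q)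
      _ (inj₂ (inj₁ (even-t , _ , _)))         → contradiction even-t (2∤odd q)
      _ (inj₂ (inj₂ (inj₁ (_ , _ , le))))      → ∸⇒+ n t refl le
      _ (inj₂ (inj₂ (inj₂ (_ , odd-n , _))))   → contradiction 2∣n odd-n
  ; case⇐ = λ le → inj₂ (inj₂ (inj₁ (2∤odd q , 2∣n , +⇒∸ n t refl le)))
  }
  where
  n = 2 + 2 * r
  t = 1 + 2 * q
  2∣n : 2 ∣ n
  2∣n = subst (2 ∣_) (sym (two r)) (2∣even (suc r))

odd-odd : ∀ r q {c} → let n = 3 + 2 * r; t = 1 + 2 * q in
          (n ∸ 2) + ((t ∸ (n ∸ 2)) / 2 ⊔ 0) ≡ c → LongTrail n t c → c < n + t →
          (∀ {ℓ u} → Colorable n ℓ u (n + t) → ℓ + c ≤ full n t) → Analysis n t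
odd-odd r q {c} loss≡c T c< mx = record
  { loss  = c
  ; long  = T
  ; loss< = c<
  ; max   = mx
  ; case⇒ = λ where
      _ (inj₁ (even-t , _))                    → contradiction even-t (2∤odd q)
      _ (inj₂ (inj₁ (even-t , _ , _)))         → contradiction even-t (2∤odd q)
      _ (inj₂ (inj₂ (inj₁ (_ , even-n , _))))  → contradiction even-n odd-n
      _ (inj₂ (inj₂ (inj₂ (_ , _ , le))))      → ∸⇒+ n t loss≡c le
  ; case⇐ = λ le → inj₂ (inj₂ (inj₂ (2∤odd q , odd-n , +⇒∸ n t loss≡c le)))
  }
  where
  n = 3 + 2 * r
  t = 1 + 2 * q
  odd-n : 2 ∤ n
  odd-n = subst (2 ∤_) (cong suc (sym (two r))) (2∤odd (suc r))

-- Here `t ≤ n - 2`, so the maximum in the fourth case is 0 and the bound that counts clique colours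
-- alone is attained.
odd-odd-few : ∀ r q → q ≤ r → Analysis (3 + 2 * r) (1 + 2 * q)
odd-odd-few r q q≤r = odd-odd r q loss≡ (long-odd-odd-few r q q≤r)
    (s≤s (s≤s (≤-trans (n≤1+n (2 * r)) (m≤m+n (1 + 2 * r) (1 + 2 * q)))))
    (λ col → odd-few-bound col q (1 + 2 * r) refl refl)
  where
  loss≡ : 1 + 2 * r + ((2 * q ∸ 2 * r) / 2 ⊔ 0) ≡ 1 + 2 * r
  loss≡ rewrite m≤n⇒m∸n≡0 (*-monoʳ-≤ 2 q≤r) = +-identityʳ _

-- Here `e` is half of `t - (n - 2)`, and the sharp bound is the one that uses the odd degrees of
-- all vertices of H.
odd-odd-many : ∀ r e → Analysis (3 + 2 * r) (1 + 2 * (e + r))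
odd-odd-many r e = odd-odd r (e + r) loss≡ (long-odd-odd-many r e)
    (≤-trans (m≤m+n _ (2 + (e + 2 * r))) (≤-reflexive (eq e r)))
    (λ col → odd-many-bound col e r refl refl)
  where
  eq : ∀ e r → suc (e + (1 + 2 * r)) + (2 + (e + 2 * r)) ≡ 3 + 2 * r + (1 + 2 * (e + r))
  eq = solve-∀
  loss≡ : 1 + 2 * r + ((2 * (e + r) ∸ 2 * r) / 2 ⊔ 0) ≡ e + (1 + 2 * r)
  loss≡ = begin
    1 + 2 * r + ((2 * (e + r) ∸ 2 * r) / 2 ⊔ 0)  ≡⟨ cong (λ d → 1 + 2 * r + (d / 2 ⊔ 0)) diff ⟩
    1 + 2 * r + (e * 2 / 2 ⊔ 0)                  ≡⟨ cong (λ d → 1 + 2 * r + (d ⊔ 0)) (m*n/n≡m e 2) ⟩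
    1 + 2 * r + (e ⊔ 0)                          ≡⟨ cong (1 + 2 * r +_) (⊔-identityʳ e) ⟩
    1 + 2 * r + e                                ≡⟨ +-comm (1 + 2 * r) e ⟩
    e + (1 + 2 * r)                              ∎
    where
    open ≡-Reasoning
    diff : 2 * (e + r) ∸ 2 * r ≡ e * 2
    diff = trans (cong (_∸ 2 * r) (*-distribˡ-+ 2 e r)) (trans (m+n∸n≡m (2 * e) (2 * r)) (*-comm 2 e))

analysis : ∀ {n} t → 3 ≤ n → Analysis n t
analysis {n} t 3≤n with evenOrOdd n | evenOrOdd t
... | is-even zero    | _      = contradiction 3≤n λ ()
... | is-even (suc r) | is-even q = subst (λ n → Analysis n (2 * q)) (two r) (even-even r q)
... | is-even (suc r) | is-odd q  = subst (λ n → Analysis n (1 + 2 * q)) (two r) (odd-even r q)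
... | is-odd r        | is-even q = even-odd r q
... | is-odd zero     | is-odd q  = contradiction 3≤n λ { (s≤s ()) }
... | is-odd (suc r)  | is-odd q  with q ≤? r
...   | yes q≤r = subst (λ n → Analysis n (1 + 2 * q)) (cong suc (two r)) (odd-odd-few r q q≤r)
...   | no  q≰r = subst₂ Analysis (cong suc (two r)) (cong (λ q → 1 + 2 * q) (m∸n+n≡m (≰⇒≥ q≰r)))
                    (odd-odd-many r (q ∸ r))

-- The harmonious chromatic number

long⇒colorable : ∀ {n t loss ℓ} (u : Fin n) → ℓ + loss ≤ full n t → LongTrail n t loss →
                 Colorable n ℓ u (n + t)
long⇒colorable {n} {t} {loss} {ℓ} u le (ℓ′ , T , eq) =
  trail⇒colorable u (m≤m+n n t) (+-cancelʳ-≤ loss ℓ ℓ′ (≤-trans le (≤-reflexive (sym eq)))) T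

theorem23 : (n m t : ℕ) (u : Fin n) → 3 ≤ n → 2 ≤ m →
    Least (λ s → m ≤ bound n s) t →
    (ColorableCase n m t → h[ lollipop n m u ]≡ n + t) ×
    (¬ ColorableCase n m t → h[ lollipop n m u ]≡ n + t + 1)
theorem23 n (suc ℓ) t u 3≤n _ (m≤bound , least) =
    (λ case → (1≤ t , long⇒colorable u (A.case⇒ ℓ≤full case) A.long) , λ j (_ , col) → at-least j col)
  , (λ ¬case → (≤-trans (1≤ t) (m≤m+n (n + t) 1) , subst (Colorable n ℓ u) (sym n+t+1) next)
             , λ j (_ , col) → ≤-trans (≤-reflexive (+-comm (n + t) 1))
                 -- If `n + t` colours sufficed, maximality would put `m` into one of the listed
                 -- cases.
                 (≤∧≢⇒< (at-least j col) (λ { refl → ¬case (A.case⇐ (A.max col)) })))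
  where
  module A = Analysis (analysis t 3≤n)
  module A′ = Analysis (analysis (suc t) 3≤n)

  1≤ : ∀ t → 1 ≤ n + t
  1≤ t = ≤-trans (s≤s z≤n) (≤-trans 3≤n (m≤m+n n t))

  ℓ≤full : ℓ ≤ full n t
  ℓ≤full = s≤s⁻¹ (≤-trans m≤bound (≤-reflexive (bound≡ n t)))

  n+t+1 : n + t + 1 ≡ n + suc t
  n+t+1 = trans (+-assoc n t 1) (cong (n +_) (+-comm t 1))

  -- The clique needs `n` colours, and the edge count makes `j ∸ n` one of the numbers among which
  -- `t` is least.
  at-least : ∀ j → Colorable n ℓ u j → n + t ≤ j
  at-least j col = ≤-trans
    (+-monoʳ-≤ n (least (j ∸ n)
      (≤-trans (s≤s (colorable⇒≤full col′)) (≤-reflexive (sym (bound≡ n (j ∸ n)))))))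
    (≤-reflexive (m+[n∸m]≡n n≤j))
    where
    n≤j = colorable⇒n≤k col
    col′ : Colorable n ℓ u (n + (j ∸ n))
    col′ = subst (Colorable n ℓ u) (sym (m+[n∸m]≡n n≤j)) col

  -- One more colour adds `n + t` edges to H, and the loss at `suc t` is at most that.
  next : Colorable n ℓ u (n + suc t)
  next = long⇒colorable u (begin
    ℓ + A′.loss              ≤⟨ +-mono-≤ ℓ≤full (s≤s⁻¹ (≤-trans A′.loss< (≤-reflexive (+-suc n t)))) ⟩
    full n t + (n + t)       ≡⟨ eq n t (triangle t) ⟩
    full n (suc t)           ∎) A′.long
    where
    open ≤-Reasoning
    eq : ∀ n t d → n * t + d + (n + t) ≡ n * suc t + (t + d)
    eq = solve-∀
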